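{- Let $G=(V,E)$ be a graph. For $v\in V$ let $\delta(v)$ be the set of edges incident to $v$, and for a partition $V_1,\dots,V_k$ of $V$ into nonempty sets let $\delta(V_1,\dots,V_k)$ be the set of edges whose endpoints lie in different parts. Suppose $(\mathbf{x}^*,\mathbf{y}^*,\mathbf{z}^*,\mathbf{t}^*)\in\mathbb{R}^{E}\times\mathbb{R}^{E}\times\mathbb{R}^{E}\times\mathbb{R}^{E}$ satisfies the following constraints: (4.1) $x_e=y_e+2z_e$ for all $e\in E$; (4.2) $\sum_{e\in F}(1-y_e)+\sum_{e\in\delta(v)\setminus F}y_e\ge 1$ for every $v\in V$ and every $F\subseteq\delta(v)$ with $|F|$ odd; (4.3) $\sum_{e\in\delta(V_1,\dots,V_k)}t_e\ge k-1$ for every partition $V_1,\dots,V_k$ of $V$ into nonempty sets; (4.4) $t_e\le y_e+z_e\le 1$ for all $e\in E$; (4.5) $0\le t_e\le 1$ for all $e\in E$; (4.6) $0\le z_e\le 1$ for all $e\in E$; (4.7) $y_e\in\{0,1\}$ for all $e\in E$. Then $\mathbf{x}^*=\mathbf{y}^*+2\mathbf{z}^*$ indicates an edge set that is an Euler tour, or is a convex combination of (incidence vectors of) Euler tours.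
   Context: An Euler tour (GTSP tour) of $G$ is a vector $\boldsymbol{\chi}\in\mathbb{Z}_{\ge 0}^{E}$, interpreted as a multigraph on $V$ using edge $e$ exactly $\chi_e$ times, such that this multigraph is connected, touches every vertex of $V$, and every vertex has even degree in it. -}

module Defs where

open import Level using (0ℓ)
open import Data.Nat as ℕ using (ℕ; zero; suc; _%_)
open import Data.Fin using (Fin)
open import Data.Bool using (Bool; true; false; if_then_else_)
open import Data.Product using (Σ; ∃; ∃-syntax; _×_; _,_; proj₁; proj₂)
open import Data.Sum using (_⊎_)
open import Data.List using (List; []; _∷_)
import Data.List
import Data.List.Membership.Propositional
open import Data.Empty using (⊥)
open import Relation.Nullary using (¬_; Dec; does)
open import Relation.Binary.PropositionalEquality using (_≡_)
open import Relation.Binary.Structures using (IsTotalOrder)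
open import Algebra.Bundles using (CommutativeRing)
open import Data.Fin.Properties using (_≟_)

-- The real numbers, axiomatised as a (Dedekind-)complete ordered field.
-- Any two such structures are isomorphic, so quantifying over all of them
-- is the same as speaking about ℝ.

record CompleteOrderedField : Set₁ where
  field
    commRing : CommutativeRing 0ℓ 0ℓ
  open CommutativeRing commRing public
  field
    _≤_        : Carrier → Carrier → Set
    isTotalOrder : IsTotalOrder _≈_ _≤_
    0≉1        : ¬ (0# ≈ 1#)
    inverse    : ∀ x → ¬ (x ≈ 0#) → ∃[ y ] (x * y ≈ 1#)
    +-mono-≤   : ∀ x y z → x ≤ y → (x + z) ≤ (y + z)
    *-nonneg   : ∀ x y → 0# ≤ x → 0# ≤ y → 0# ≤ (x * y)
    complete   : (P : Carrier → Set) → (∃[ a ] P a) →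
                 (∃[ b ] (∀ a → P a → a ≤ b)) →
                 ∃[ s ] ((∀ a → P a → a ≤ s) ×
                         (∀ b → (∀ a → P a → a ≤ b) → s ≤ b))

module _ (R : CompleteOrderedField) where
  open CompleteOrderedField R

  fromℕ : ℕ → Carrier
  fromℕ zero    = 0#
  fromℕ (suc n) = 1# + fromℕ n

  sumF : ∀ m → (Fin m → Carrier) → Carrier
  sumF zero    f = 0#
  sumF (suc m) f = f Fin.zero + sumF m (λ i → f (Fin.suc i))

  sumL : List Carrier → Carrier
  sumL []       = 0#
  sumL (a ∷ as) = a + sumL as

record Graph : Set where
  field
    n    : ℕ
    m    : ℕ
    ends : Fin m → Fin n × Fin n
  src : Fin m → Fin n
  src e = proj₁ (ends e)
  tgt : Fin m → Fin n
  tgt e = proj₂ (ends e)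

record IsSimple (G : Graph) : Set where
  open Graph G
  field
    loopless : ∀ e → ¬ (src e ≡ tgt e)
    noParallel : ∀ e e' →
      ((src e ≡ src e' × tgt e ≡ tgt e') ⊎ (src e ≡ tgt e' × tgt e ≡ src e')) →
      e ≡ e'

module _ (G : Graph) where
  open Graph G

  Incident : Fin n → Fin m → Set
  Incident v e = (src e ≡ v) ⊎ (tgt e ≡ v)

  incident? : Fin n → Fin m → Bool
  incident? v e = if does (src e ≟ v) then true else does (tgt e ≟ v)

  sumℕ : ∀ k → (Fin k → ℕ) → ℕ
  sumℕ zero    f = 0
  sumℕ (suc k) f = f Fin.zero ℕ.+ sumℕ k (λ i → f (Fin.suc i))

  degree : (Fin m → ℕ) → Fin n → ℕ
  degree χ v = sumℕ m (λ e → if incident? v e then χ e else 0)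

  data Reach (χ : Fin m → ℕ) : Fin n → Fin n → Set where
    here : ∀ {u} → Reach χ u u
    step : ∀ {u w} e → 1 ℕ.≤ χ e →
           ((src e ≡ u × tgt e ≡ w) ⊎ (tgt e ≡ u × src e ≡ w)) →
           ∀ {v} → Reach χ w v → Reach χ u v

  record EulerTour (χ : Fin m → ℕ) : Set where
    field
      connected : ∀ u v → Reach χ u v
      touches   : ∀ v → 1 ℕ.≤ degree χ v
      even      : ∀ v → degree χ v % 2 ≡ 0

  card : (Fin m → Bool) → ℕ
  card F = sumℕ m (λ e → if F e then 1 else 0)

  crossing : ∀ {k} → (Fin n → Fin k) → Fin m → Bool
  crossing p e = if does (p (src e) ≟ p (tgt e)) then false else true

  IsPartition : ∀ k → (Fin n → Fin k) → Set
  IsPartition k p = ∀ (i : Fin k) → ∃[ v ] (p v ≡ i)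

  module _ (R : CompleteOrderedField) where
    open CompleteOrderedField R

    record Feasible (x y z t : Fin m → Carrier) : Set where
      field
        c4-1 : ∀ e → x e ≈ (y e + (1# + 1#) * z e)
        c4-2 : ∀ v (F : Fin m → Bool) →
               (∀ e → F e ≡ true → Incident v e) →
               card F % 2 ≡ 1 →
               1# ≤ sumF R m (λ e → if F e then 1# - y e
                                    else (if incident? v e then y e else 0#))
        c4-3 : ∀ k (p : Fin n → Fin k) → IsPartition k p →
               (fromℕ R k - 1#) ≤ sumF R m (λ e → if crossing p e then t e else 0#)
        c4-4 : ∀ e → (t e ≤ (y e + z e)) × ((y e + z e) ≤ 1#)
        c4-5 : ∀ e → (0# ≤ t e) × (t e ≤ 1#)
        c4-6 : ∀ e → (0# ≤ z e) × (z e ≤ 1#)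
        c4-7 : ∀ e → (y e ≈ 0#) ⊎ (y e ≈ 1#)

    ConvexCombOfEulerTours : (Fin m → Carrier) → Set
    ConvexCombOfEulerTours x =
      ∃[ L ] ( (∀ {c} → c Data.List.Membership.Propositional.∈ L →
                    (0# ≤ proj₁ c) × EulerTour (proj₂ c))
             × (sumL R (Data.List.map proj₁ L) ≈ 1#)
             × (∀ e → x e ≈ sumL R (Data.List.map (λ c → proj₁ c * fromℕ R (proj₂ c e)) L)) )

{-# OPTIONS --safe #-}

-- Let Y be the set of edges with y = 1; (4.2) applied to F = Y ∩ δ(v) shows
-- that Y is even.  By (4.4), u = y + z is 1 on Y and z is 0 there, so it
-- suffices to write u as a convex combination of connected spanning edge sets S:
-- each gives the tour using the edges of Y once and those of S ∖ Y twice.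
--
-- Writing k(B) for the number of components of (V, B), (4.3)–(4.5) give
-- u(E ∖ B) ≥ k(B) − 1 for every edge set B, and k is supermodular.  Hence the
-- edge sets tight for u are closed under union.  If some tight B misses a
-- fractional edge, take a maximal such B; integrality of k(B) − 1 makes it miss two
-- fractional edges e and f, and by maximality no tight set separates them, so u
-- can be moved both ways along 1ₑ − 1_f.  If there is no such B, u can be moved
-- along 1ₑ for any fractional e.  Moving until a new constraint becomes tight
-- shows by induction that u is a convex combination of 0/1 points of the same
-- polyhedron, and those are connected spanning edge sets.
module Submission where

open import Defs
open import Algebra.Bundles using (CommutativeRing)
import Algebra.Solver.Ring
open import Algebra.Solver.Ring.AlmostCommutativeRing
  using (_-Raw-AlmostCommutative⟶_; fromCommutativeRing)
open import Data.Bool as Bool using (Bool; true; false; if_then_else_; not; _∧_; _∨_)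
open import Data.Empty using (⊥-elim)
open import Data.Fin as Fin using (Fin; punchIn; punchOut)
import Data.Fin.Properties as Fin
open import Data.Fin.Subset using (Subset; _∩_; _∪_; _⊂_)
open import Data.Fin.Subset.Induction using (⊃-wellFounded)
open import Data.Fin.Subset.Properties using (anySubset?; _⊂?_; p⊆p∪q; x∈p∪q⁺)
open import Data.Integer as ℤ using (ℤ; +_; -[1+_])
import Data.Integer.Properties as ℤ
open import Data.List using (List; []; _∷_; _++_; map; allFin)
open import Data.List.Membership.Propositional using (_∈_)
open import Data.List.Membership.Propositional.Properties
  using (∈-allFin; ∈-map⁺; ∈-map⁻; ∈-++⁺ˡ; ∈-++⁺ʳ; ∈-++⁻)
open import Data.List.Relation.Unary.All as All using (All; []; _∷_)
open import Data.List.Relation.Unary.Any as Any using (Any; here; there)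
import Data.Maybe as Maybe
open import Data.Nat as ℕ using (ℕ; zero; suc; _%_)
open import Data.Nat.DivMod using ([m+kn]%n≡m%n; m%n<n)
open import Data.Nat.Induction using (<-wellFounded)
import Data.Nat.Properties as ℕ
open import Data.Nat.Solver using (module +-*-Solver)
open import Data.Product using (∃-syntax; _×_; _,_; proj₁; proj₂; swap)
import Data.Sign as Sign
open import Data.Sum as Sum using (_⊎_; inj₁; inj₂; [_,_]′)
open import Data.Vec as Vec using (lookup; tabulate)
open import Data.Vec.Properties using (lookup-zipWith; lookup∘tabulate; lookup⇒[]=; []=⇒lookup)
open import Function using (_∘_; id)
open import Induction.WellFounded using (Acc; acc)
open import Level using (0ℓ)
open import Relation.Binary using (Rel; Symmetric; Transitive; _⇒_)
open import Relation.Binary.PropositionalEquality as ≡ using (_≡_; _≢_)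
import Relation.Binary.Reasoning.Setoid as SetoidReasoning
open import Relation.Binary.Structures using (IsTotalOrder)
open import Relation.Nullary using (¬_; Dec; yes; no; does)
open import Relation.Nullary.Decidable using (¬?; _×-dec_; decidable-stable; dec⇒maybe)
open import Relation.Unary using (Decidable)

-- Ordered fields

module IntegerSolver (C : CommutativeRing 0ℓ 0ℓ) where
  open CommutativeRing C
  open import Algebra.Properties.Semiring.Mult.TCOptimised semiring
    using (1+×; ×-homo-+; ×1-homo-*) renaming (_×_ to _⋆_)
  open import Algebra.Properties.Ring ring
    using (-0#≈0#; -‿involutive; -‿distribˡ-*; -‿distribʳ-*)
  open import Algebra.Properties.AbelianGroup +-abelianGroup using (⁻¹-∙-comm)
  open SetoidReasoning setoid

  -- 1 ⋆ x reduces to x, so the solver's constants 0 and 1 are literally 0# and 1#.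
  fromℤ : ℤ → Carrier
  fromℤ (+ n)    = n ⋆ 1#
  fromℤ -[1+ n ] = - (suc n ⋆ 1#)

  fromℤ-neg : ∀ i → fromℤ (ℤ.- i) ≈ - fromℤ i
  fromℤ-neg (+ zero)  = sym -0#≈0#
  fromℤ-neg (+ suc n) = refl
  fromℤ-neg -[1+ n ]  = sym (-‿involutive _)

  cancel-1# : ∀ x y → x - y ≈ (1# + x) - (1# + y)
  cancel-1# x y = begin
    x - y                    ≈⟨ +-identityˡ _ ⟨
    0# + (x - y)             ≈⟨ +-congʳ (-‿inverseʳ 1#) ⟨
    (1# - 1#) + (x - y)      ≈⟨ +-assoc _ _ _ ⟩
    1# + (- 1# + (x - y))    ≈⟨ +-congˡ (+-assoc _ _ _) ⟨
    1# + ((- 1# + x) - y)    ≈⟨ +-congˡ (+-congʳ (+-comm _ _)) ⟩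
    1# + ((x + - 1#) - y)    ≈⟨ +-congˡ (+-assoc _ _ _) ⟩
    1# + (x + (- 1# + - y))  ≈⟨ +-assoc _ _ _ ⟨
    (1# + x) + (- 1# + - y)  ≈⟨ +-congˡ (⁻¹-∙-comm 1# y) ⟩
    (1# + x) - (1# + y)      ∎

  fromℤ-⊖ : ∀ m n → fromℤ (m ℤ.⊖ n) ≈ m ⋆ 1# - n ⋆ 1#
  fromℤ-⊖ zero    zero    = sym (-‿inverseʳ 0#)
  fromℤ-⊖ zero    (suc n) = sym (+-identityˡ _)
  fromℤ-⊖ (suc m) zero    = sym (trans (+-congˡ -0#≈0#) (+-identityʳ _))
  fromℤ-⊖ (suc m) (suc n) = begin
    fromℤ (suc m ℤ.⊖ suc n)                ≡⟨ ≡.cong fromℤ (ℤ.[1+m]⊖[1+n]≡m⊖n m n) ⟩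
    fromℤ (m ℤ.⊖ n)                        ≈⟨ fromℤ-⊖ m n ⟩
    m ⋆ 1# - n ⋆ 1#                        ≈⟨ cancel-1# _ _ ⟩
    (1# + m ⋆ 1#) - (1# + n ⋆ 1#)          ≈⟨ +-cong (1+× m 1#) (-‿cong (1+× n 1#)) ⟨
    suc m ⋆ 1# - suc n ⋆ 1#                ∎

  fromℤ-+ : ∀ i j → fromℤ (i ℤ.+ j) ≈ fromℤ i + fromℤ j
  fromℤ-+ (+ m)    (+ n)    = ×-homo-+ 1# m n
  fromℤ-+ (+ m)    -[1+ n ] = fromℤ-⊖ m (suc n)
  fromℤ-+ -[1+ m ] (+ n)    = trans (fromℤ-⊖ n (suc m)) (+-comm _ _)
  fromℤ-+ -[1+ m ] -[1+ n ] = begin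
    - (suc (suc (m ℕ.+ n)) ⋆ 1#)           ≡⟨ ≡.cong (λ k → - (suc k ⋆ 1#)) (≡.sym (ℕ.+-suc m n)) ⟩
    - ((suc m ℕ.+ suc n) ⋆ 1#)             ≈⟨ -‿cong (×-homo-+ 1# (suc m) (suc n)) ⟩
    - (suc m ⋆ 1# + suc n ⋆ 1#)            ≈⟨ ⁻¹-∙-comm _ _ ⟨
    - (suc m ⋆ 1#) - suc n ⋆ 1#            ∎

  fromℤ-* : ∀ i j → fromℤ (i ℤ.* j) ≈ fromℤ i * fromℤ j
  fromℤ-* (+ m) (+ n) = begin
    fromℤ (Sign.+ ℤ.◃ (m ℕ.* n))           ≡⟨ ≡.cong fromℤ (ℤ.+◃n≡+n (m ℕ.* n)) ⟩
    (m ℕ.* n) ⋆ 1#                         ≈⟨ ×1-homo-* m n ⟩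
    m ⋆ 1# * n ⋆ 1#                        ∎
  fromℤ-* (+ m) -[1+ n ] = begin
    fromℤ (Sign.- ℤ.◃ (m ℕ.* suc n))       ≡⟨ ≡.cong fromℤ (ℤ.-◃n≡-n (m ℕ.* suc n)) ⟩
    fromℤ (ℤ.- (+ (m ℕ.* suc n)))          ≈⟨ fromℤ-neg (+ (m ℕ.* suc n)) ⟩
    - ((m ℕ.* suc n) ⋆ 1#)                 ≈⟨ -‿cong (×1-homo-* m (suc n)) ⟩
    - (m ⋆ 1# * suc n ⋆ 1#)                ≈⟨ -‿distribʳ-* _ _ ⟩
    m ⋆ 1# * - (suc n ⋆ 1#)                ∎
  fromℤ-* -[1+ m ] (+ n) = begin
    fromℤ (Sign.- ℤ.◃ (suc m ℕ.* n))       ≡⟨ ≡.cong fromℤ (ℤ.-◃n≡-n (suc m ℕ.* n)) ⟩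
    fromℤ (ℤ.- (+ (suc m ℕ.* n)))          ≈⟨ fromℤ-neg (+ (suc m ℕ.* n)) ⟩
    - ((suc m ℕ.* n) ⋆ 1#)                 ≈⟨ -‿cong (×1-homo-* (suc m) n) ⟩
    - (suc m ⋆ 1# * n ⋆ 1#)                ≈⟨ -‿distribˡ-* _ _ ⟩
    - (suc m ⋆ 1#) * n ⋆ 1#                ∎
  fromℤ-* -[1+ m ] -[1+ n ] = begin
    (suc m ℕ.* suc n) ⋆ 1#                 ≈⟨ ×1-homo-* (suc m) (suc n) ⟩
    suc m ⋆ 1# * suc n ⋆ 1#                ≈⟨ -‿involutive _ ⟨
    - - (suc m ⋆ 1# * suc n ⋆ 1#)          ≈⟨ -‿cong (-‿distribˡ-* _ _) ⟩
    - (- (suc m ⋆ 1#) * suc n ⋆ 1#)        ≈⟨ -‿distribʳ-* _ _ ⟩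
    - (suc m ⋆ 1#) * - (suc n ⋆ 1#)        ∎

  homomorphism : ℤ.+-*-rawRing -Raw-AlmostCommutative⟶ fromCommutativeRing C
  homomorphism = record
    { ⟦_⟧    = fromℤ
    ; +-homo = fromℤ-+
    ; *-homo = fromℤ-*
    ; -‿homo = fromℤ-neg
    ; 0-homo = refl
    ; 1-homo = refl
    }

  -- Coefficients are integers because their equality is decidable; numerals then cancel without
  -- comparing field elements.
  open Algebra.Solver.Ring ℤ.+-*-rawRing (fromCommutativeRing C) homomorphism
    (λ i j → Maybe.map (λ eq → reflexive (≡.cong fromℤ eq)) (dec⇒maybe (i ℤ.≟ j))) public
    using (Polynomial; solve; _:=_; _:+_; _:*_; :-_; _:-_; con)

  :0 :1 : ∀ {n} → Polynomial n
  :0 = con (+ 0)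
  :1 = con (+ 1)

module OrderedField (R : CompleteOrderedField) where
  open CompleteOrderedField R public hiding (zero) renaming (_≤_ to infix 4 _≤_)
  open IsTotalOrder isTotalOrder public using (antisym; total)
    renaming (refl to ≤-refl; reflexive to ≤-reflexive; trans to ≤-trans)
  open IntegerSolver commRing public

  infix 4 _<_
  _<_ : Carrier → Carrier → Set
  x < y = ¬ (y ≤ x)

  <⇒≤ : ∀ {x y} → x < y → x ≤ y
  <⇒≤ {x} {y} x<y = [ (λ x≤y → x≤y) , (λ y≤x → ⊥-elim (x<y y≤x)) ]′ (total x y)

  ≤-resp : ∀ {a b c d} → a ≈ c → b ≈ d → a ≤ b → c ≤ d
  ≤-resp a≈c b≈d a≤b = ≤-trans (≤-reflexive (sym a≈c)) (≤-trans a≤b (≤-reflexive b≈d))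

  -- The hypothesis is b − a = d − c, with the terms moved so that no subtraction occurs.
  ≤-shift : ∀ {a b c d} → c ≤ d → b + c ≈ a + d → a ≤ b
  ≤-shift {a} {b} {c} {d} c≤d eq = ≤-resp left right (+-mono-≤ c d (a - c) c≤d)
    where
    left : c + (a - c) ≈ a
    left = solve 2 (λ a c → c :+ (a :- c) := a) refl a c
    right : d + (a - c) ≈ b
    right = trans (solve 3 (λ a c d → d :+ (a :- c) := (a :+ d) :- c) refl a c d)
              (trans (+-congʳ (sym eq)) (solve 2 (λ b c → (b :+ c) :- c := b) refl b c))

  +-mono₂-≤ : ∀ {a b c d} → a ≤ b → c ≤ d → a + c ≤ b + d
  +-mono₂-≤ {a} {b} {c} {d} a≤b c≤d = ≤-trans (+-mono-≤ a b c a≤b)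
    (≤-resp (+-comm c b) (+-comm d b) (+-mono-≤ c d b c≤d))

  ≤-shift₂ : ∀ {a b c d c′ d′} → c ≤ d → c′ ≤ d′ → b + (c + c′) ≈ a + (d + d′) → a ≤ b
  ≤-shift₂ c≤d c′≤d′ = ≤-shift (+-mono₂-≤ c≤d c′≤d′)

  0≤-+ : ∀ {a b} → 0# ≤ a → 0# ≤ b → 0# ≤ a + b
  0≤-+ 0≤a 0≤b = ≤-resp (+-identityˡ 0#) refl (+-mono₂-≤ 0≤a 0≤b)

  *-monoˡ-≤ : ∀ {a b c} → 0# ≤ a → b ≤ c → a * b ≤ a * c
  *-monoˡ-≤ {a} {b} {c} 0≤a b≤c = ≤-shift
    (*-nonneg a (c - b) 0≤a (≤-shift b≤c (solve 2 (λ b c → (c :- b) :+ b := :0 :+ c) refl b c)))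
    (solve 3 (λ a b c → a :* c :+ :0 := a :* b :+ a :* (c :- b)) refl a b c)

  neg-nonneg : ∀ {a} → a ≤ 0# → 0# ≤ - a
  neg-nonneg {a} a≤0 = ≤-shift a≤0 (solve 1 (λ a → :- a :+ a := :0 :+ :0) refl a)

  0≤1 : 0# ≤ 1#
  0≤1 with total 0# 1#
  ... | inj₁ 0≤1 = 0≤1
  ... | inj₂ 1≤0 = ≤-resp refl (solve 0 ((:- :1) :* (:- :1) := :1) refl)
                     (*-nonneg (- 1#) (- 1#) (neg-nonneg 1≤0) (neg-nonneg 1≤0))

  0<1 : 0# < 1#
  0<1 1≤0 = 0≉1 (antisym 0≤1 1≤0)

  1+x≰x : ∀ {x} → ¬ (1# + x ≤ x)
  1+x≰x {x} h = 0<1 (≤-shift h (solve 1 (λ x → :0 :+ (:1 :+ x) := :1 :+ x) refl x))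

  -- The doubly negated zeros form a bounded set closed under addition, so
  -- their supremum s satisfies s ≤ s − a for each of them.
  ≈-stable : ∀ {x y} → ¬ ¬ (x ≈ y) → x ≈ y
  ≈-stable {x} {y} ¬¬x≈y = trans (solve 2 (λ x y → x := (x :- y) :+ y) refl x y)
      (trans (+-congʳ (antisym (nonpos x-y∈N) 0≤x-y)) (+-identityˡ y))
    where
    N : Carrier → Set
    N a = ¬ ¬ (a ≈ 0#)
    N-≤1 : ∀ a → N a → a ≤ 1#
    N-≤1 a a∈N with total a 1#
    ... | inj₁ a≤1 = a≤1
    ... | inj₂ 1≤a = ⊥-elim (a∈N (λ a≈0 → 0<1 (≤-resp refl a≈0 1≤a)))
    sup = complete N (0# , λ n → n refl) (1# , N-≤1)
    s   = proj₁ sup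
    N-+ : ∀ {a b} → N a → N b → N (a + b)
    N-+ a∈N b∈N k = a∈N (λ a≈0 → b∈N (λ b≈0 → k (trans (+-cong a≈0 b≈0) (+-identityˡ 0#))))
    nonpos : ∀ {a} → N a → a ≤ 0#
    nonpos {a} a∈N = ≤-shift (proj₂ (proj₂ sup) (s - a) below)
        (solve 2 (λ a s → :0 :+ s := a :+ (s :- a)) refl a s)
      where
      below : ∀ b → N b → b ≤ s - a
      below b b∈N = ≤-shift (proj₁ (proj₂ sup) (a + b) (N-+ a∈N b∈N))
        (solve 3 (λ a b s → (s :- a) :+ (a :+ b) := b :+ s) refl a b s)
    x-y∈N : N (x - y)
    x-y∈N k = ¬¬x≈y (λ x≈y → k (trans (+-congʳ x≈y) (-‿inverseʳ y)))
    0≤x-y : 0# ≤ x - y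
    0≤x-y = ≤-shift (nonpos {y - x} (λ k → ¬¬x≈y (λ x≈y → k (trans (+-congˡ (-‿cong x≈y)) (-‿inverseʳ y)))))
              (solve 2 (λ x y → (x :- y) :+ (y :- x) := :0 :+ :0) refl x y)

  -- Compare with 1 the supremum of {0} ∪ {2 | Q}.
  weak-excluded-middle : (Q : Set) → (¬ Q) ⊎ (¬ ¬ Q)
  weak-excluded-middle Q = [ (λ s≤1 → inj₁ (λ q → 1+x≰x (≤-trans (upper _ (inj₂ (refl , q))) s≤1)))
                           , (λ 1≤s → inj₂ (λ ¬q → 0<1 (≤-trans 1≤s (least 0# (P-≤0 ¬q)))))
                           ]′ (total (proj₁ sup) 1#)
    where
    P : Carrier → Set
    P a = (a ≈ 0#) ⊎ ((a ≈ 1# + 1#) × Q)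
    P-≤2 : ∀ a → P a → a ≤ 1# + 1#
    P-≤2 a (inj₁ a≈0)       = ≤-resp (sym a≈0) refl (0≤-+ 0≤1 0≤1)
    P-≤2 a (inj₂ (a≈2 , _)) = ≤-reflexive a≈2
    P-≤0 : ¬ Q → ∀ a → P a → a ≤ 0#
    P-≤0 ¬q a (inj₁ a≈0)     = ≤-reflexive a≈0
    P-≤0 ¬q a (inj₂ (_ , q)) = ⊥-elim (¬q q)
    sup   = complete P (0# , inj₁ refl) (1# + 1# , P-≤2)
    upper = proj₁ (proj₂ sup)
    least = proj₂ (proj₂ sup)

  infix 4 _≈?_ _≤?_

  abstract
    -- Weak excluded middle leaves a refutation or a double negation, and stability turns the latter
    -- into an equality.
    _≈?_ : ∀ x y → Dec (x ≈ y)
    x ≈? y = [ no , (λ ¬¬x≈y → yes (≈-stable ¬¬x≈y)) ]′ (weak-excluded-middle (x ≈ y))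

  _≤?_ : ∀ x y → Dec (x ≤ y)
  x ≤? y with total x y
  ... | inj₁ x≤y = yes x≤y
  ... | inj₂ y≤x with x ≈? y
  ...   | yes x≈y = yes (≤-reflexive x≈y)
  ...   | no  x≉y = no (λ x≤y → x≉y (antisym x≤y y≤x))

  abstract
    -- An inverse `b ≤ 0` would make `a * - b`, which is -1, nonnegative.
    positive-inverse : ∀ {a} → 0# < a → ∃[ b ] ((0# ≤ b) × (a * b ≈ 1#))
    positive-inverse {a} 0<a with inverse a (λ a≈0 → 0<a (≤-reflexive a≈0))
    ... | b , ab≈1 with total 0# b
    ...   | inj₁ 0≤b = b , 0≤b , ab≈1
    ...   | inj₂ b≤0 = ⊥-elim (0<1 (≤-shift (*-nonneg a (- b) (<⇒≤ 0<a) (neg-nonneg b≤0))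
              (trans (+-congʳ (sym (-‿inverseʳ 1#)))
                (trans (+-congʳ (+-congˡ (-‿cong (sym ab≈1))))
                  (solve 2 (λ a b → :1 :- a :* b :+ :0 := :1 :+ a :* (:- b)) refl a b)))))

  fromℕ-+ : ∀ a b → fromℕ R (a ℕ.+ b) ≈ fromℕ R a + fromℕ R b
  fromℕ-+ zero    b = sym (+-identityˡ _)
  fromℕ-+ (suc a) b = trans (+-congˡ (fromℕ-+ a b)) (sym (+-assoc _ _ _))

  fromℕ-nonneg : ∀ a → 0# ≤ fromℕ R a
  fromℕ-nonneg zero    = ≤-refl
  fromℕ-nonneg (suc a) = 0≤-+ 0≤1 (fromℕ-nonneg a)

  fromℕ-mono-≤ : ∀ {a b} → a ℕ.≤ b → fromℕ R a ≤ fromℕ R b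
  fromℕ-mono-≤ {b = b} ℕ.z≤n = fromℕ-nonneg b
  fromℕ-mono-≤ (ℕ.s≤s a≤b)   = +-mono₂-≤ ≤-refl (fromℕ-mono-≤ a≤b)

  -- Brings real inequalities back to natural numbers: `b < a` would give
  -- `1# + fromℕ R b ≤ fromℕ R b`.
  fromℕ-cancel-≤ : ∀ {a b} → fromℕ R a ≤ fromℕ R b → a ℕ.≤ b
  fromℕ-cancel-≤ {a} {b} h with a ℕ.≤? b
  ... | yes a≤b = a≤b
  ... | no  a≰b = ⊥-elim (1+x≰x (≤-trans (fromℕ-mono-≤ (ℕ.≰⇒> a≰b)) h))

  -- Finite sums.

  ∑ : ∀ {m} → (Fin m → Carrier) → Carrier
  ∑ {m} = sumF R m

  ∑-cong : ∀ {m} {f g : Fin m → Carrier} → (∀ e → f e ≈ g e) → ∑ f ≈ ∑ g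
  ∑-cong {zero}  f≈g = refl
  ∑-cong {suc m} f≈g = +-cong (f≈g Fin.zero) (∑-cong (λ e → f≈g (Fin.suc e)))

  ∑-mono-≤ : ∀ {m} {f g : Fin m → Carrier} → (∀ e → f e ≤ g e) → ∑ f ≤ ∑ g
  ∑-mono-≤ {zero}  f≤g = ≤-refl
  ∑-mono-≤ {suc m} f≤g = +-mono₂-≤ (f≤g Fin.zero) (∑-mono-≤ (λ e → f≤g (Fin.suc e)))

  ∑-+ : ∀ {m} (f g : Fin m → Carrier) → ∑ (λ e → f e + g e) ≈ ∑ f + ∑ g
  ∑-+ {zero}  f g = sym (+-identityˡ 0#)
  ∑-+ {suc m} f g = trans (+-congˡ (∑-+ (λ e → f (Fin.suc e)) (λ e → g (Fin.suc e))))
    (solve 4 (λ a b c d → (a :+ b) :+ (c :+ d) := (a :+ c) :+ (b :+ d)) refl _ _ _ _)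

  ∑-*ˡ : ∀ {m} a (f : Fin m → Carrier) → ∑ (λ e → a * f e) ≈ a * ∑ f
  ∑-*ˡ {zero}  a f = sym (zeroʳ a)
  ∑-*ˡ {suc m} a f = trans (+-congˡ (∑-*ˡ a (λ e → f (Fin.suc e)))) (sym (distribˡ a _ _))

  ∑-zero : ∀ {m} {f : Fin m → Carrier} → (∀ e → f e ≈ 0#) → ∑ f ≈ 0#
  ∑-zero {zero}  f≈0 = refl
  ∑-zero {suc m} f≈0 = trans (+-cong (f≈0 Fin.zero) (∑-zero (λ e → f≈0 (Fin.suc e)))) (+-identityˡ 0#)

  ∑-single : ∀ {m} (e : Fin m) (g : Fin m → Carrier) →
             ∑ (λ j → if does (j Fin.≟ e) then g j else 0#) ≈ g e
  ∑-single {suc m} Fin.zero    g = trans (+-congˡ (∑-zero {m} (λ _ → refl))) (+-identityʳ _)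
  ∑-single {suc m} (Fin.suc e) g = trans (+-identityˡ _) (∑-single e (λ j → g (Fin.suc j)))

  ∑-01-isℕ : ∀ {m} {f : Fin m → Carrier} → (∀ e → (f e ≈ 0#) ⊎ (f e ≈ 1#)) → ∃[ N ] (∑ f ≈ fromℕ R N)
  ∑-01-isℕ {zero}  f01 = 0 , refl
  ∑-01-isℕ {suc m} f01 with f01 Fin.zero | ∑-01-isℕ (λ e → f01 (Fin.suc e))
  ... | inj₁ f≈0 | N , eq = N , trans (+-cong f≈0 eq) (+-identityˡ _)
  ... | inj₂ f≈1 | N , eq = suc N , +-cong f≈1 eq

-- Components of edge sets

-- The quotient map merging labels `i` and `j`: label `j` is removed by renumbering, and `j` itself
-- goes where `i` goes.
identify : ∀ {k} {i j : Fin (suc k)} → i ≢ j → Fin (suc k) → Fin k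
identify {j = j} i≢j x with x Fin.≟ j
... | yes _   = punchOut (i≢j ∘ ≡.sym)
... | no  x≢j = punchOut (x≢j ∘ ≡.sym)

identify-≡ : ∀ {k} {i j : Fin (suc k)} (i≢j : i ≢ j) → identify i≢j i ≡ identify i≢j j
identify-≡ {i = i} {j} i≢j with i Fin.≟ j | j Fin.≟ j
... | yes i≡j | _      = ⊥-elim (i≢j i≡j)
... | no _    | no j≢j = ⊥-elim (j≢j ≡.refl)
... | no _    | yes _  = Fin.punchOut-cong j ≡.refl

identify-injective : ∀ {k} {i j : Fin (suc k)} (i≢j : i ≢ j) {x y} → identify i≢j x ≡ identify i≢j y →
                     x ≡ y ⊎ (x ≡ i × y ≡ j) ⊎ (x ≡ j × y ≡ i)
identify-injective {j = j} i≢j {x} {y} eq with x Fin.≟ j | y Fin.≟ j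
... | yes x≡j | yes y≡j = inj₁ (≡.trans x≡j (≡.sym y≡j))
... | yes x≡j | no  y≢j = inj₂ (inj₂ (x≡j , ≡.sym (Fin.punchOut-injective (i≢j ∘ ≡.sym) (y≢j ∘ ≡.sym) eq)))
... | no  x≢j | yes y≡j = inj₂ (inj₁ (Fin.punchOut-injective (x≢j ∘ ≡.sym) (i≢j ∘ ≡.sym) eq , y≡j))
... | no  x≢j | no  y≢j = inj₁ (Fin.punchOut-injective (x≢j ∘ ≡.sym) (y≢j ∘ ≡.sym) eq)

-- Since `punchIn j` is a section, a glued labelling is again surjective.
identify-punchIn : ∀ {k} {i j : Fin (suc k)} (i≢j : i ≢ j) y → identify i≢j (punchIn j y) ≡ y
identify-punchIn {j = j} i≢j y with punchIn j y Fin.≟ j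
... | yes eq = ⊥-elim (Fin.punchInᵢ≢i j y eq)
... | no  _  = ≡.trans (Fin.punchOut-cong j ≡.refl) (Fin.punchOut-punchIn j)

-- A partition with numbered classes. Surjectivity makes `size` the exact number of classes and is
-- what `IsPartition` asks for.
record Labelling (n : ℕ) : Set where
  constructor labelling
  field
    size  : ℕ
    label : Fin n → Fin size
    onto  : ∀ i → ∃[ v ] (label v ≡ i)
open Labelling

module _ {n : ℕ} where

  Ker : Labelling n → Rel (Fin n) 0ℓ
  Ker P u v = label P u ≡ label P v

  -- Choosing a representative in each class of `Q` and reading its label in `P` is injective when
  -- `P` refines `Q`.
  size-antitone : ∀ P Q → Ker P ⇒ Ker Q → size Q ℕ.≤ size P
  size-antitone P Q P⇒Q = Fin.injective⇒≤ {f = λ i → label P (proj₁ (onto Q i))}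
    (λ {i} {j} eq → ≡.trans (≡.sym (proj₂ (onto Q i))) (≡.trans (P⇒Q eq) (proj₂ (onto Q j))))

  discrete : Labelling n
  discrete = labelling n id (λ i → i , ≡.refl)

  glue : (P : Labelling n) (a b : Fin n) → label P a ≢ label P b → Labelling n
  glue (labelling zero    l o) a b a≢b = ⊥-elim (Fin.¬Fin0 (l a))
  glue (labelling (suc k) l o) a b a≢b = labelling k (identify a≢b ∘ l)
    (λ i → let v , eq = o (punchIn (l b) i)
           in v , ≡.trans (≡.cong (identify a≢b) eq) (identify-punchIn a≢b i))

  join : Labelling n → Fin n → Fin n → Labelling n
  join P a b with label P a Fin.≟ label P b
  ... | yes _   = P
  ... | no  a≢b = glue P a b a≢b

  join-⇒ : ∀ P a b → Ker P ⇒ Ker (join P a b)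
  join-⇒ P a b eq with label P a Fin.≟ label P b
  join-⇒ P a b eq                     | yes _   = eq
  join-⇒ (labelling zero l o) a b eq    | no _ = ⊥-elim (Fin.¬Fin0 (l a))
  join-⇒ (labelling (suc k) l o) a b eq | no a≢b = ≡.cong (identify a≢b) eq

  join-joins : ∀ P a b → Ker (join P a b) a b
  join-joins P a b with label P a Fin.≟ label P b
  join-joins P a b                       | yes a≡b = a≡b
  join-joins (labelling zero l o) a b    | no _ = ⊥-elim (Fin.¬Fin0 (l a))
  join-joins (labelling (suc k) l o) a b | no a≢b = identify-≡ a≢b

  -- With `join-⇒` and `join-joins` this characterises the kernel of the join as the least
  -- equivalence relation containing `Ker P` and the pair `a`, `b`.
  join-least : ∀ P a b {E : Rel (Fin n) 0ℓ} → Symmetric E → Transitive E →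
               Ker P ⇒ E → E a b → Ker (join P a b) ⇒ E
  join-least P a b E-sym E-trans P⇒E ab eq with label P a Fin.≟ label P b
  join-least P a b E-sym E-trans P⇒E ab eq | yes _ = P⇒E eq
  join-least (labelling zero l o) a b E-sym E-trans P⇒E ab eq | no _ = ⊥-elim (Fin.¬Fin0 (l a))
  join-least (labelling (suc k) l o) a b E-sym E-trans P⇒E ab eq | no a≢b with identify-injective a≢b eq
  ... | inj₁ x≡y                 = P⇒E x≡y
  ... | inj₂ (inj₁ (x≡a , y≡b)) = E-trans (P⇒E x≡a) (E-trans ab (P⇒E (≡.sym y≡b)))
  ... | inj₂ (inj₂ (x≡b , y≡a)) = E-trans (P⇒E x≡b) (E-trans (E-sym ab) (P⇒E (≡.sym y≡a)))

  -- Diminishing returns: joining `a` and `b` lowers the class count of the coarser `Q` by no more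
  -- than that of `P`, since a pair already joined in `P` is joined in `Q`. The additive form avoids
  -- truncated subtraction.
  join-size : ∀ P Q a b → Ker P ⇒ Ker Q →
              size Q ℕ.+ size (join P a b) ℕ.≤ size P ℕ.+ size (join Q a b)
  join-size P Q a b P⇒Q with label P a Fin.≟ label P b | label Q a Fin.≟ label Q b
  join-size P Q a b P⇒Q | yes _  | yes _ = ℕ.≤-reflexive (ℕ.+-comm (size Q) (size P))
  join-size P Q a b P⇒Q | yes eq | no ne = ⊥-elim (ne (P⇒Q eq))
  join-size (labelling zero l o) Q a b P⇒Q | no _ | _ = ⊥-elim (Fin.¬Fin0 (l a))
  join-size (labelling (suc k) l o) Q a b P⇒Q | no _ | yes _ =
    ℕ.≤-trans (ℕ.≤-reflexive (ℕ.+-comm (size Q) k)) (ℕ.n≤1+n _)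
  join-size (labelling (suc k) l o) (labelling zero l′ o′) a b P⇒Q | no _ | no _ = ⊥-elim (Fin.¬Fin0 (l′ a))
  join-size (labelling (suc k) l o) (labelling (suc k′) l′ o′) a b P⇒Q | no _ | no _ =
    ℕ.≤-reflexive (≡.cong suc (ℕ.+-comm k′ k))

module Components (G : Graph) where
  open Graph G

  joinAll : Labelling n → (Fin m → Bool) → List (Fin m) → Labelling n
  joinAll P B []       = P
  joinAll P B (e ∷ es) with B e
  ... | true  = joinAll (join P (src e) (tgt e)) B es
  ... | false = joinAll P B es

  joinAll-⇒ : ∀ P B es → Ker P ⇒ Ker (joinAll P B es)
  joinAll-⇒ P B []       eq = eq
  joinAll-⇒ P B (e ∷ es) eq with B e
  ... | true  = joinAll-⇒ (join P (src e) (tgt e)) B es (join-⇒ P (src e) (tgt e) eq)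
  ... | false = joinAll-⇒ P B es eq

  joinAll-joins : ∀ P B {es e} → e ∈ es → B e ≡ true → Ker (joinAll P B es) (src e) (tgt e)
  joinAll-joins P B {e ∷ es} (here ≡.refl) Be with B e
  joinAll-joins P B {e ∷ es} (here ≡.refl) () | false
  ... | true = joinAll-⇒ (join P (src e) (tgt e)) B es (join-joins P (src e) (tgt e))
  joinAll-joins P B {e′ ∷ es} (there e∈es) Be with B e′
  ... | true  = joinAll-joins (join P (src e′) (tgt e′)) B e∈es Be
  ... | false = joinAll-joins P B e∈es Be

  joinAll-least : ∀ P B es {E : Rel (Fin n) 0ℓ} → Symmetric E → Transitive E →
                  Ker P ⇒ E → (∀ e → B e ≡ true → E (src e) (tgt e)) → Ker (joinAll P B es) ⇒ E
  joinAll-least P B []       E-sym E-trans P⇒E BE eq = P⇒E eq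
  joinAll-least P B (e ∷ es) E-sym E-trans P⇒E BE eq with B e in Be
  ... | true  = joinAll-least (join P (src e) (tgt e)) B es E-sym E-trans
                  (join-least P (src e) (tgt e) E-sym E-trans P⇒E (BE e Be)) BE eq
  ... | false = joinAll-least P B es E-sym E-trans P⇒E BE eq

  -- Diminishing returns telescope along the list, because joining the same pair in both keeps `P`
  -- finer than `Q`.
  joinAll-size : ∀ P Q B es → Ker P ⇒ Ker Q →
                 size Q ℕ.+ size (joinAll P B es) ℕ.≤ size P ℕ.+ size (joinAll Q B es)
  joinAll-size P Q B []       P⇒Q = ℕ.≤-reflexive (ℕ.+-comm (size Q) (size P))
  joinAll-size P Q B (e ∷ es) P⇒Q with B e
  ... | false = joinAll-size P Q B es P⇒Q
  ... | true  = exchange (size P₁) (size Q₁) (join-size P Q (src e) (tgt e) P⇒Q)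
                  (joinAll-size P₁ Q₁ B es
                    (join-least P (src e) (tgt e) ≡.sym ≡.trans
                      (join-⇒ Q (src e) (tgt e) ∘ P⇒Q) (join-joins Q (src e) (tgt e))))
    where
    P₁ = join P (src e) (tgt e)
    Q₁ = join Q (src e) (tgt e)
    -- Adds the inequalities for the first edge and for the remaining ones; the intermediate sizes
    -- `p₁` and `q₁` cancel.
    exchange : ∀ {p q p′ q′} p₁ q₁ →
               q ℕ.+ p₁ ℕ.≤ p ℕ.+ q₁ → q₁ ℕ.+ p′ ℕ.≤ p₁ ℕ.+ q′ → q ℕ.+ p′ ℕ.≤ p ℕ.+ q′
    exchange {p} {q} {p′} {q′} p₁ q₁ h₁ h₂ = ℕ.+-cancelʳ-≤ (p₁ ℕ.+ q₁) _ _ (begin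
      (q ℕ.+ p′) ℕ.+ (p₁ ℕ.+ q₁) ≡⟨ lhs ⟩
      (q ℕ.+ p₁) ℕ.+ (q₁ ℕ.+ p′) ≤⟨ ℕ.+-mono-≤ h₁ h₂ ⟩
      (p ℕ.+ q₁) ℕ.+ (p₁ ℕ.+ q′) ≡⟨ rhs ⟩
      (p ℕ.+ q′) ℕ.+ (p₁ ℕ.+ q₁) ∎)
      where
      open ℕ.≤-Reasoning
      open +-*-Solver
      lhs = solve 4 (λ q p′ p₁ q₁ → (q :+ p′) :+ (p₁ :+ q₁) := (q :+ p₁) :+ (q₁ :+ p′)) ≡.refl q p′ p₁ q₁
      rhs = solve 4 (λ p q₁ p₁ q′ → (p :+ q₁) :+ (p₁ :+ q′) := (p :+ q′) :+ (p₁ :+ q₁)) ≡.refl p q₁ p₁ q′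

  components : Subset m → Labelling n
  components B = joinAll discrete (lookup B) (allFin m)

  components-joins : ∀ B {e} → lookup B e ≡ true → Ker (components B) (src e) (tgt e)
  components-joins B {e} = joinAll-joins discrete (lookup B) (∈-allFin e)

  -- Used with two kinds of `E`: kernels, to compare partitions, and reachability, to turn equal
  -- labels into a walk.
  components-least : ∀ B {E : Rel (Fin n) 0ℓ} → (∀ {v} → E v v) → Symmetric E → Transitive E →
                     (∀ e → lookup B e ≡ true → E (src e) (tgt e)) → Ker (components B) ⇒ E
  components-least B {E} E-refl E-sym E-trans =
    joinAll-least discrete (lookup B) (allFin m) E-sym E-trans (λ { ≡.refl → E-refl })

  -- Adding the edges of `A` lowers the count at least as much from `A ∩ B` as from the coarser `B`;
  -- the first addition arrives at `A`, the second at `A ∪ B`.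
  components-supermodular : ∀ A B → size (components A) ℕ.+ size (components B) ℕ.≤
                                    size (components (A ∩ B)) ℕ.+ size (components (A ∪ B))
  components-supermodular A B = begin
    size (components A) ℕ.+ size (components B)
      ≡⟨ ℕ.+-comm (size (components A)) _ ⟩
    size (components B) ℕ.+ size (components A)
      ≤⟨ ℕ.+-monoʳ-≤ (size (components B)) (size-antitone A∩B+A (components A) A∩B+A⇒A) ⟩
    size (components B) ℕ.+ size A∩B+A
      ≤⟨ joinAll-size (components (A ∩ B)) (components B) (lookup A) (allFin m) A∩B⇒B ⟩
    size (components (A ∩ B)) ℕ.+ size B+A
      ≤⟨ ℕ.+-monoʳ-≤ (size (components (A ∩ B))) (size-antitone (components (A ∪ B)) B+A A∪B⇒B+A) ⟩
    size (components (A ∩ B)) ℕ.+ size (components (A ∪ B)) ∎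
    where
    open ℕ.≤-Reasoning
    A∩B+A = joinAll (components (A ∩ B)) (lookup A) (allFin m)
    B+A   = joinAll (components B) (lookup A) (allFin m)
    ∧-true : ∀ {a b} → a ∧ b ≡ true → a ≡ true × b ≡ true
    ∧-true {true} {true} _ = ≡.refl , ≡.refl
    ∨-true : ∀ {a b} → a ∨ b ≡ true → a ≡ true ⊎ b ≡ true
    ∨-true {true}         _ = inj₁ ≡.refl
    ∨-true {false} {true} _ = inj₂ ≡.refl
    ∈∩ : ∀ {e} → lookup (A ∩ B) e ≡ true → lookup A e ≡ true × lookup B e ≡ true
    ∈∩ {e} h = ∧-true (≡.trans (≡.sym (lookup-zipWith _∧_ e A B)) h)
    A∩B⇒B : Ker (components (A ∩ B)) ⇒ Ker (components B)
    A∩B⇒B = components-least (A ∩ B) ≡.refl ≡.sym ≡.trans (λ e h → components-joins B (proj₂ (∈∩ h)))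
    A∩B+A⇒A : Ker A∩B+A ⇒ Ker (components A)
    A∩B+A⇒A = joinAll-least (components (A ∩ B)) (lookup A) (allFin m) ≡.sym ≡.trans
      (components-least (A ∩ B) ≡.refl ≡.sym ≡.trans (λ e h → components-joins A (proj₁ (∈∩ h))))
      (λ e → components-joins A)
    A∪B⇒B+A : Ker (components (A ∪ B)) ⇒ Ker B+A
    A∪B⇒B+A = components-least (A ∪ B) ≡.refl ≡.sym ≡.trans
      (λ e h → [ joinAll-joins (components B) (lookup A) (∈-allFin e)
               , (λ h → joinAll-⇒ (components B) (lookup A) (allFin m) (components-joins B h)) ]′
               (∨-true (≡.trans (≡.sym (lookup-zipWith _∨_ e A B)) h)))

-- Integrality of the polyhedron

count : {A : Set} {P : A → Set} → Decidable P → List A → ℕ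
count P? []       = 0
count P? (x ∷ xs) = (if does (P? x) then 1 else 0) ℕ.+ count P? xs

count-mono-≤ : {A : Set} {P Q : A → Set} (P? : Decidable P) (Q? : Decidable Q) →
               (∀ {x} → P x → Q x) → ∀ xs → count P? xs ℕ.≤ count Q? xs
count-mono-≤ P? Q? P⇒Q []       = ℕ.z≤n
count-mono-≤ P? Q? P⇒Q (x ∷ xs) with P? x | Q? x
... | yes _  | yes _  = ℕ.s≤s (count-mono-≤ P? Q? P⇒Q xs)
... | yes px | no ¬qx = ⊥-elim (¬qx (P⇒Q px))
... | no _   | yes _  = ℕ.m≤n⇒m≤1+n (count-mono-≤ P? Q? P⇒Q xs)
... | no _   | no _   = count-mono-≤ P? Q? P⇒Q xs

count-mono-< : {A : Set} {P Q : A → Set} (P? : Decidable P) (Q? : Decidable Q) →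
               (∀ {x} → P x → Q x) → ∀ {xs} → Any (λ x → Q x × ¬ P x) xs → count P? xs ℕ.< count Q? xs
count-mono-< P? Q? P⇒Q {x ∷ xs} any with P? x | Q? x
count-mono-< P? Q? P⇒Q {x ∷ xs} any                    | yes px | no ¬qx = ⊥-elim (¬qx (P⇒Q px))
count-mono-< P? Q? P⇒Q {x ∷ xs} (here (_ , ¬px))       | yes px | yes _  = ⊥-elim (¬px px)
count-mono-< P? Q? P⇒Q {x ∷ xs} (there any)            | yes _  | yes _  = ℕ.s≤s (count-mono-< P? Q? P⇒Q any)
count-mono-< P? Q? P⇒Q {x ∷ xs} any                    | no _   | yes _  = ℕ.s≤s (count-mono-≤ P? Q? P⇒Q xs)
count-mono-< P? Q? P⇒Q {x ∷ xs} (here (qx , _))        | no _   | no ¬qx = ⊥-elim (¬qx qx)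
count-mono-< P? Q? P⇒Q {x ∷ xs} (there any)            | no _   | no _   = count-mono-< P? Q? P⇒Q any

subsets : ∀ m → List (Subset m)
subsets zero    = Vec.[] ∷ []
subsets (suc m) = map (true Vec.∷_) (subsets m) ++ map (false Vec.∷_) (subsets m)

∈-subsets : ∀ {m} (B : Subset m) → B ∈ subsets m
∈-subsets Vec.[]            = here ≡.refl
∈-subsets (true  Vec.∷ B) = ∈-++⁺ˡ (∈-map⁺ (true Vec.∷_) (∈-subsets B))
∈-subsets (false Vec.∷ B) = ∈-++⁺ʳ (map (true Vec.∷_) (subsets _)) (∈-map⁺ (false Vec.∷_) (∈-subsets B))

-- Stated for any supermodular `k`, of which the number of components is an instance.
module BoxPolyhedron (R : CompleteOrderedField) {m : ℕ} (k : Subset m → ℕ)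
  (k-supermodular : ∀ A B → k A ℕ.+ k B ℕ.≤ k (A ∩ B) ℕ.+ k (A ∪ B)) where
  open OrderedField R

  Vector : Set
  Vector = Fin m → Carrier

  off : Subset m → Vector → Vector
  off B u e = if lookup B e then 0# else u e

  -- u e ≥ 0, u e ≤ 1 and u(E ∖ B) ≥ k B − 1, respectively.
  data Constraint : Set where
    lower upper : Fin m → Constraint
    cut         : Subset m → Constraint

  slack : Constraint → Vector → Carrier
  slack (lower e) u = u e
  slack (upper e) u = 1# - u e
  slack (cut B)   u = (1# + ∑ (off B u)) - fromℕ R (k B)

  -- The linear part of `slack`, that is, its derivative along `d`.
  rate : Constraint → Vector → Carrier
  rate (lower e) d = d e
  rate (upper e) d = - d e
  rate (cut B)   d = ∑ (off B d)

  Inside : Vector → Set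
  Inside u = ∀ c → 0# ≤ slack c u

  move : Vector → Carrier → Vector → Vector
  move u ε d e = u e + ε * d e

  ∑off-move : ∀ B u ε d → ∑ (off B (move u ε d)) ≈ ∑ (off B u) + ε * ∑ (off B d)
  ∑off-move B u ε d = trans (∑-cong pointwise)
    (trans (∑-+ (off B u) (λ e → ε * off B d e)) (+-congˡ (∑-*ˡ ε (off B d))))
    where
    pointwise : ∀ e → off B (move u ε d) e ≈ off B u e + ε * off B d e
    pointwise e with lookup B e
    ... | true  = sym (trans (+-identityˡ _) (zeroʳ ε))
    ... | false = refl

  slack-move : ∀ c u ε d → slack c (move u ε d) ≈ slack c u + ε * rate c d
  slack-move (lower e) u ε d = refl
  slack-move (upper e) u ε d =
    solve 3 (λ u ε d → :1 :- (u :+ ε :* d) := (:1 :- u) :+ ε :* (:- d)) refl (u e) ε (d e)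
  slack-move (cut B)   u ε d = trans (+-congʳ (+-congˡ (∑off-move B u ε d)))
    (solve 4 (λ s ε r k → (:1 :+ (s :+ ε :* r)) :- k := ((:1 :+ s) :- k) :+ ε :* r)
       refl _ ε _ _)

  rate-neg : ∀ c d → rate c (λ e → - d e) ≈ - rate c d
  rate-neg (lower e) d = refl
  rate-neg (upper e) d = refl
  rate-neg (cut B)   d = trans (∑-cong pointwise) (trans (∑-*ˡ (- 1#) (off B d))
      (solve 1 (λ x → (:- :1) :* x := :- x) refl _))
    where
    pointwise : ∀ e → off B (λ e → - d e) e ≈ - 1# * off B d e
    pointwise e with lookup B e
    ... | true  = sym (zeroʳ _)
    ... | false = solve 1 (λ x → :- x := (:- :1) :* x) refl _

  constraints : List Constraint
  constraints = map lower (allFin m) ++ (map upper (allFin m) ++ map cut (subsets m))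

  ∈-constraints : ∀ c → c ∈ constraints
  ∈-constraints (lower e) = ∈-++⁺ˡ (∈-map⁺ lower (∈-allFin e))
  ∈-constraints (upper e) = ∈-++⁺ʳ (map lower (allFin m)) (∈-++⁺ˡ (∈-map⁺ upper (∈-allFin e)))
  ∈-constraints (cut B)   = ∈-++⁺ʳ (map lower (allFin m))
    (∈-++⁺ʳ (map upper (allFin m)) (∈-map⁺ cut (∈-subsets B)))

  -- Steps to the boundary.

  Loose : Vector → Constraint → Set
  Loose u c = ¬ (slack c u ≈ 0#)

  loose? : ∀ u → Decidable (Loose u)
  loose? u c = ¬? (slack c u ≈? 0#)

  -- The measure of the induction: a step keeps tight constraints tight and makes a loose one tight.
  looseness : Vector → ℕ
  looseness u = count (loose? u) constraints

  -- The slack is affine in the step length and nonnegative at both 0 and `ε`, hence in between.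
  within : ∀ {s r δ ε} → 0# ≤ s → 0# ≤ δ → δ ≤ ε → 0# ≤ s + ε * r → 0# ≤ s + δ * r
  within {s} {r} {δ} {ε} 0≤s 0≤δ δ≤ε h with total 0# r
  ... | inj₁ 0≤r = 0≤-+ 0≤s (*-nonneg δ r 0≤δ 0≤r)
  ... | inj₂ r≤0 = ≤-shift₂ h (*-monoˡ-≤ (neg-nonneg r≤0) δ≤ε)
      (solve 4 (λ s r δ ε → (s :+ δ :* r) :+ (:0 :+ (:- r) :* δ)
                         := :0 :+ ((s :+ ε :* r) :+ (:- r) :* ε)) refl s r δ ε)

  -- The step is s / (-r), with `w` the inverse of `- r`: there the decreasing slack reaches 0.
  breakpoint : ∀ {s r} → 0# ≤ s → ¬ (s ≈ 0#) → r < 0# → ∃[ ε ] ((0# < ε) × (s + ε * r ≈ 0#))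
  breakpoint {s} {r} 0≤s s≉0 r<0 = s * w , 0<sw , tight
    where
    0<-r : 0# < - r
    0<-r -r≤0 = r<0 (≤-shift -r≤0 (solve 1 (λ r → r :+ :- r := :0 :+ :0) refl r))
    w = proj₁ (positive-inverse 0<-r)
    -rw≈1 : - r * w ≈ 1#
    -rw≈1 = proj₂ (proj₂ (positive-inverse 0<-r))
    s≈sw[-r] : s ≈ s * w * - r
    s≈sw[-r] = trans (sym (*-identityʳ s)) (trans (*-congˡ (sym -rw≈1))
      (solve 3 (λ s w r → s :* (:- r :* w) := s :* w :* (:- r)) refl s w r))
    0<sw : 0# < s * w
    0<sw sw≤0 = s≉0 (antisym (≤-resp (sym s≈sw[-r]) (zeroʳ (- r))
      (≤-resp (*-comm _ _) refl (*-monoˡ-≤ (neg-nonneg (<⇒≤ r<0)) sw≤0))) 0≤s)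
    tight : s + s * w * r ≈ 0#
    tight = trans (+-congʳ s≈sw[-r]) (solve 3 (λ s w r → s :* w :* (:- r) :+ s :* w :* r := :0) refl s w r)

  Steps : {C : Set} (s r : C → Carrier) → List C → Set
  Steps s r cs = ∃[ ε ] ((0# < ε) × All (λ c → 0# ≤ s c + ε * r c) cs ×
                         Any (λ c → ¬ (s c ≈ 0#) × s c + ε * r c ≈ 0#) cs)

  -- The ratio test: the smallest breakpoint among the constraints of negative rate keeps every
  -- slack nonnegative and makes a loose constraint tight. Zero rates on tight constraints make
  -- every breakpoint positive.
  step-length : {C : Set} (s r : C → Carrier) →
    (∀ c → 0# ≤ s c) → (∀ c → s c ≈ 0# → r c ≈ 0#) → (cs : List C) →
    All (λ c → 0# ≤ r c) cs ⊎ Steps s r cs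
  step-length s r 0≤s tight [] = inj₁ []
  step-length s r 0≤s tight (c ∷ cs) with 0# ≤? r c | step-length s r 0≤s tight cs
  ... | yes 0≤r | inj₁ all = inj₁ (0≤r ∷ all)
  ... | yes 0≤r | inj₂ (ε , 0<ε , all , any) =
    inj₂ (ε , 0<ε , 0≤-+ (0≤s c) (*-nonneg ε (r c) (<⇒≤ 0<ε) 0≤r) ∷ all , there any)
  ... | no  r<0 | rest = inj₂ (choose (breakpoint (0≤s c) s≉0 r<0) rest)
    where
    s≉0 : ¬ (s c ≈ 0#)
    s≉0 s≈0 = r<0 (≤-reflexive (sym (tight c s≈0)))
    choose : ∃[ ε ] ((0# < ε) × (s c + ε * r c ≈ 0#)) →
             All (λ c → 0# ≤ r c) cs ⊎ Steps s r cs → Steps s r (c ∷ cs)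
    choose (ε₀ , 0<ε₀ , eq) (inj₁ all) = ε₀ , 0<ε₀ , ≤-reflexive (sym eq) ∷
      All.map (λ {c′} 0≤r → 0≤-+ (0≤s c′) (*-nonneg ε₀ (r c′) (<⇒≤ 0<ε₀) 0≤r)) all , here (s≉0 , eq)
    choose (ε₀ , 0<ε₀ , eq) (inj₂ (ε , 0<ε , all , any)) with total ε₀ ε
    ... | inj₁ ε₀≤ε = ε₀ , 0<ε₀ , ≤-reflexive (sym eq) ∷
      All.map (λ {c′} h → within (0≤s c′) (<⇒≤ 0<ε₀) ε₀≤ε h) all , here (s≉0 , eq)
    ... | inj₂ ε≤ε₀ = ε , 0<ε ,
      within (0≤s c) (<⇒≤ 0<ε) ε≤ε₀ (≤-reflexive (sym eq)) ∷ all , there any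

  -- For `u` inside the polyhedron, a direction of the minimal face containing `u`: it can be
  -- followed both ways, so `u` is not a vertex.
  record Direction (u d : Vector) : Set where
    field
      tight-rate : ∀ c → slack c u ≈ 0# → rate c d ≈ 0#
      nonzero    : ∃[ e ] ¬ (d e ≈ 0#)
  open Direction

  opposite : ∀ {u d} → Direction u d → Direction u (λ e → - d e)
  opposite {u} {d} dir = record
    { tight-rate = λ c t → trans (rate-neg c d) (trans (-‿cong (tight-rate dir c t)) -0≈0)
    ; nonzero    = proj₁ (nonzero dir) , λ -d≈0 → proj₂ (nonzero dir)
        (trans (solve 1 (λ x → x := :- (:- x)) refl _) (trans (-‿cong -d≈0) -0≈0))
    }
    where
    -0≈0 : - 0# ≈ 0#
    -0≈0 = solve 0 (:- :0 := :0) refl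

  advance : ∀ {u d} → Inside u → Direction u d →
            ∃[ ε ] ((0# < ε) × Inside (move u ε d) × looseness (move u ε d) ℕ.< looseness u)
  advance {u} {d} in-u dir
    with step-length (λ c → slack c u) (λ c → rate c d) in-u (tight-rate dir) constraints
  -- The polyhedron is bounded: without a negative rate, the two bounds at `e` force `d e` to be 0.
  ... | inj₁ all = ⊥-elim (proj₂ (nonzero dir) (antisym
          (≤-shift (All.lookup all (∈-constraints (upper e)))
            (solve 1 (λ x → :0 :+ :0 := x :+ :- x) refl (d e)))
          (All.lookup all (∈-constraints (lower e)))))
    where e = proj₁ (nonzero dir)
  ... | inj₂ (ε , 0<ε , all , any) = ε , 0<ε
    , (λ c → ≤-resp refl (sym (slack-move c u ε d)) (All.lookup all (∈-constraints c)))
    , count-mono-< (loose? (move u ε d)) (loose? u)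
        (λ {c} loose t → loose (trans (slack-move c u ε d)
           (trans (+-cong t (trans (*-congˡ (tight-rate dir c t)) (zeroʳ ε))) (+-identityˡ 0#))))
        (Any.map (λ {c} (s≉0 , h) → s≉0 , λ loose → loose (trans (slack-move c u ε d) h)) any)

  indicator : Fin m → Vector
  indicator e j = if does (j Fin.≟ e) then 1# else 0#

  indicator-≢ : ∀ {e j} → j ≢ e → indicator e j ≈ 0#
  indicator-≢ {e} {j} j≢e with j Fin.≟ e
  ... | yes j≡e = ⊥-elim (j≢e j≡e)
  ... | no  _   = refl

  indicator-≡ : ∀ e → indicator e e ≈ 1#
  indicator-≡ e with e Fin.≟ e
  ... | yes _   = refl
  ... | no  e≢e = ⊥-elim (e≢e ≡.refl)

  ∑off-indicator : ∀ B e → ∑ (off B (indicator e)) ≈ (if lookup B e then 0# else 1#)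
  ∑off-indicator B e = trans (∑-cong pointwise) (∑-single e (λ j → if lookup B j then 0# else 1#))
    where
    pointwise : ∀ j → off B (indicator e) j ≈
                      (if does (j Fin.≟ e) then (if lookup B j then 0# else 1#) else 0#)
    pointwise j with lookup B j | does (j Fin.≟ e)
    ... | true  | true  = refl
    ... | true  | false = refl
    ... | false | true  = refl
    ... | false | false = refl

  lookup-∪ : ∀ (A B : Subset m) e → lookup (A ∪ B) e ≡ lookup A e ∨ lookup B e
  lookup-∪ A B e = lookup-zipWith _∨_ e A B

  ∑off-modular : ∀ A B u → ∑ (off A u) + ∑ (off B u) ≈ ∑ (off (A ∪ B) u) + ∑ (off (A ∩ B) u)
  ∑off-modular A B u = trans (sym (∑-+ (off A u) (off B u)))
      (trans (∑-cong pointwise) (∑-+ (off (A ∪ B) u) (off (A ∩ B) u)))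
    where
    pointwise : ∀ e → off A u e + off B u e ≈ off (A ∪ B) u e + off (A ∩ B) u e
    pointwise e rewrite lookup-∪ A B e | lookup-zipWith _∧_ e A B with lookup A e | lookup B e
    ... | true  | true  = refl
    ... | true  | false = refl
    ... | false | true  = +-comm _ _
    ... | false | false = refl

  -- Uncrossing tight cuts.

  Tight : Vector → Subset m → Set
  Tight u B = slack (cut B) u ≈ 0#

  tight-≈ : ∀ {u} B → Tight u B → fromℕ R (k B) ≈ 1# + ∑ (off B u)
  tight-≈ B t = trans (solve 2 (λ s k → k := s :- (s :- k)) refl _ _)
    (trans (+-congˡ (-‿cong t)) (solve 1 (λ s → s :- :0 := s) refl _))

  -- The slack of a cut is submodular, its sum being modular and `k` supermodular. So the slacks of
  -- `A ∪ B` and `A ∩ B` add up to at most 0, and both are nonnegative.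
  tight-∪ : ∀ {u} → Inside u → ∀ A B → Tight u A → Tight u B → Tight u (A ∪ B)
  tight-∪ {u} in-u A B tA tB = antisym (≤-shift₂ k-sup (in-u (cut (A ∩ B))) identity) (in-u (cut (A ∪ B)))
    where
    k-sup : fromℕ R (k A) + fromℕ R (k B) ≤ fromℕ R (k (A ∩ B)) + fromℕ R (k (A ∪ B))
    k-sup = ≤-resp (fromℕ-+ (k A) (k B)) (fromℕ-+ (k (A ∩ B)) (k (A ∪ B))) (fromℕ-mono-≤ (k-supermodular A B))
    identity : 0# + ((fromℕ R (k A) + fromℕ R (k B)) + 0#) ≈
               slack (cut (A ∪ B)) u + ((fromℕ R (k (A ∩ B)) + fromℕ R (k (A ∪ B))) + slack (cut (A ∩ B)) u)
    identity = trans (+-congˡ (+-congʳ (+-cong (tight-≈ A tA) (tight-≈ B tB))))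
      (trans (solve 2 (λ a b → :0 :+ (((:1 :+ a) :+ (:1 :+ b)) :+ :0)
                            := :1 :+ :1 :+ (a :+ b)) refl _ _)
      (trans (+-congˡ (∑off-modular A B u))
        (solve 4 (λ s t k l → :1 :+ :1 :+ (s :+ t)
           := ((:1 :+ s) :- k) :+ ((l :+ k) :+ ((:1 :+ t) :- l))) refl _ _ _ _)))

  Integral : Carrier → Set
  Integral a = (a ≈ 0#) ⊎ (a ≈ 1#)

  integral? : ∀ a → Dec (Integral a)
  integral? a with a ≈? 0# | a ≈? 1#
  ... | yes a≈0 | _       = yes (inj₁ a≈0)
  ... | no  a≉0 | yes a≈1 = yes (inj₂ a≈1)
  ... | no  a≉0 | no  a≉1 = no [ a≉0 , a≉1 ]′

  Misses : Vector → Subset m → Fin m → Set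
  Misses u B e = lookup B e ≡ false × ¬ Integral (u e)

  misses? : ∀ u B → Decidable (Misses u B)
  misses? u B e = (lookup B e Bool.≟ false) ×-dec ¬? (integral? (u e))

  -- A tight cut has an integral sum, so its fractional elements cannot be unique.
  another-fractional : ∀ {u} → Inside u → ∀ B → Tight u B → ∀ {e} →
                       Misses u B e → ∃[ f ] (f ≢ e × Misses u B f)
  another-fractional {u} in-u B t {e} (e∉B , fractional)
    with Fin.any? (λ f → ¬? (f Fin.≟ e) ×-dec misses? u B f)
  ... | yes found = found
  ... | no  none  = ⊥-elim (fractional (cases (ℕ.m≤n⇒m<n∨m≡n low)))
    where
    others : Vector
    others j = if does (j Fin.≟ e) then 0# else off B u j
    others-integral : ∀ j → Integral (others j)
    others-integral j with j Fin.≟ e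
    ... | yes _ = inj₁ refl
    ... | no j≢e with lookup B j in j∉B
    ...   | true  = inj₁ refl
    ...   | false with integral? (u j)
    ...     | yes i = i
    ...     | no ¬i = ⊥-elim (none (j , j≢e , j∉B , ¬i))
    N = proj₁ (∑-01-isℕ others-integral)
    split : ∀ j → off B u j ≈ others j + (if does (j Fin.≟ e) then off B u j else 0#)
    split j with does (j Fin.≟ e)
    ... | true  = sym (+-identityˡ _)
    ... | false = sym (+-identityʳ _)
    off-e : off B u e ≈ u e
    off-e rewrite e∉B = refl
    -- With 0 ≤ `u e` ≤ 1 this leaves only `k B` = N + 1 and `k B` = N + 2, where `u e` is 0 and 1
    -- respectively.
    total-≈ : fromℕ R (k B) ≈ fromℕ R (suc N) + u e
    total-≈ = trans (tight-≈ B t) (trans (+-congˡ (trans (∑-cong split)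
      (trans (∑-+ others _) (+-cong (proj₂ (∑-01-isℕ others-integral)) (trans (∑-single e (off B u)) off-e)))))
      (sym (+-assoc _ _ _)))
    low : suc N ℕ.≤ k B
    low = fromℕ-cancel-≤ (≤-shift (in-u (lower e))
      (trans (+-congʳ total-≈) (+-identityʳ _)))
    high : k B ℕ.≤ suc (suc N)
    high = fromℕ-cancel-≤ (≤-shift (in-u (upper e))
      (trans (solve 2 (λ n u → (:1 :+ n) :+ :0 := (n :+ u) :+ (:1 :- u)) refl (fromℕ R (suc N)) (u e))
        (+-congʳ (sym total-≈))))
    u≈ : u e ≈ fromℕ R (k B) - fromℕ R (suc N)
    u≈ = trans (solve 2 (λ n u → u := (n :+ u) :- n) refl (fromℕ R (suc N)) (u e)) (+-congʳ (sym total-≈))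
    cases : suc N ℕ.< k B ⊎ suc N ≡ k B → Integral (u e)
    cases (inj₁ lt) = inj₂ (trans u≈ (trans (+-congʳ (reflexive (≡.cong (fromℕ R) (ℕ.≤-antisym high lt))))
      (solve 1 (λ n → (:1 :+ n) :- n := :1) refl (fromℕ R (suc N)))))
    cases (inj₂ eq) = inj₁ (trans u≈ (trans (+-congʳ (reflexive (≡.cong (fromℕ R) (≡.sym eq)))) (-‿inverseʳ _)))

  TightMissing : Vector → Subset m → Set
  TightMissing u B = Tight u B × ∃[ e ] Misses u B e

  tightMissing? : ∀ u → Decidable (TightMissing u)
  tightMissing? u B = (slack (cut B) u ≈? 0#) ×-dec Fin.any? (misses? u B)

  Maximal : Vector → Subset m → Set
  Maximal u B = ∀ B′ → B ⊂ B′ → ¬ TightMissing u B′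

  maximal-above : ∀ u B → TightMissing u B → Acc (λ A B → B ⊂ A) B →
                  ∃[ B′ ] (TightMissing u B′ × Maximal u B′)
  maximal-above u B tm (acc rec) with anySubset? (λ B′ → (B ⊂? B′) ×-dec tightMissing? u B′)
  ... | yes (B′ , B⊂B′ , tm′) = maximal-above u B′ tm′ (rec B⊂B′)
  ... | no  none              = B , tm , λ B′ B⊂B′ tm′ → none (B′ , B⊂B′ , tm′)

  -- By tight-∪, a tight A containing f but not e would enlarge the maximal B to B ∪ A.
  maximal-exchange : ∀ {u} → Inside u → ∀ {B} → Tight u B → Maximal u B →
                     ∀ {e f} → Misses u B e → Misses u B f →
                     ∀ A → Tight u A → lookup A e ≡ false → lookup A f ≡ false
  maximal-exchange {u} in-u {B} tB maximal {e} {f} (e∉B , fractional) (f∉B , _) A tA e∉A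
    with lookup A f in f∈A
  ... | false = ≡.refl
  ... | true  = ⊥-elim (maximal (B ∪ A)
      (p⊆p∪q A , f , x∈p∪q⁺ (inj₂ (lookup⇒[]= f A f∈A))
        , λ f∈B → true≢false (≡.trans (≡.sym ([]=⇒lookup f∈B)) f∉B))
      (tight-∪ in-u B A tB tA , e , ≡.trans (lookup-∪ B A e) (≡.cong₂ _∨_ e∉B e∉A) , fractional))
    where
    true≢false : true ≢ false
    true≢false ()

  -- A tight bound makes its coordinate integral, so vanishing at the integral coordinates settles
  -- all lower and upper constraints.
  direction-from : ∀ {u d} → (∀ j → Integral (u j) → d j ≈ 0#) → (∀ A → Tight u A → ∑ (off A d) ≈ 0#) →
                   ∃[ e ] ¬ (d e ≈ 0#) → Direction u d
  direction-from {u} {d} supp cuts nz = record { tight-rate = rates ; nonzero = nz }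
    where
    rates : ∀ c → slack c u ≈ 0# → rate c d ≈ 0#
    rates (lower j) t = supp j (inj₁ t)
    rates (upper j) t = trans (-‿cong (supp j (inj₂ u≈1))) (solve 0 (:- :0 := :0) refl)
      where
      u≈1 : u j ≈ 1#
      u≈1 = trans (solve 1 (λ u → u := :1 :- (:1 :- u)) refl (u j))
        (trans (+-congˡ (-‿cong t)) (solve 0 (:1 :- :0 := :1) refl))
    rates (cut A)   t = cuts A t

  -- By maximality a tight set contains both `e` and `f` or neither, so the two contributions to its
  -- cut cancel. The difference of indicators is written as a `move` so that `∑off-move` computes
  -- its rates.
  exchange-direction : ∀ {u} → Inside u → ∀ {B} → Tight u B → Maximal u B → ∀ {e f} →
                       f ≢ e → Misses u B e → Misses u B f →
                       Direction u (move (indicator e) (- 1#) (indicator f))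
  exchange-direction {u} in-u {B} tB maximal {e} {f} f≢e mB-e mB-f = direction-from supp cuts (e , d-e≉0)
    where
    supp : ∀ j → Integral (u j) → move (indicator e) (- 1#) (indicator f) j ≈ 0#
    supp j i = trans (+-cong (indicator-≢ {e} {j} (λ { ≡.refl → proj₂ mB-e i }))
                             (*-congˡ (indicator-≢ {f} {j} (λ { ≡.refl → proj₂ mB-f i }))))
      (trans (+-congˡ (zeroʳ _)) (+-identityˡ 0#))
    balance : ∀ {a b} → (a ≡ false → b ≡ false) → (b ≡ false → a ≡ false) →
              (if a then 0# else 1#) + - 1# * (if b then 0# else 1#) ≈ 0#
    balance {true}  {true}  a⇒b b⇒a = trans (+-identityˡ _) (zeroʳ _)
    balance {false} {false} a⇒b b⇒a = solve 0 (:1 :+ (:- :1) :* :1 := :0) refl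
    balance {true}  {false} a⇒b b⇒a with () ← b⇒a ≡.refl
    balance {false} {true}  a⇒b b⇒a with () ← a⇒b ≡.refl
    cuts : ∀ A → Tight u A → ∑ (off A (move (indicator e) (- 1#) (indicator f))) ≈ 0#
    cuts A tA = trans (∑off-move A (indicator e) (- 1#) (indicator f))
      (trans (+-cong (∑off-indicator A e) (*-congˡ (∑off-indicator A f)))
        (balance (maximal-exchange in-u tB maximal mB-e mB-f A tA)
                 (maximal-exchange in-u tB maximal mB-f mB-e A tA)))
    d-e≉0 : ¬ (move (indicator e) (- 1#) (indicator f) e ≈ 0#)
    d-e≉0 d≈0 = 0≉1 (trans (sym d≈0)
      (trans (+-cong (indicator-≡ e) (*-congˡ (indicator-≢ (λ e≡f → f≢e (≡.sym e≡f)))))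
        (solve 0 (:1 :+ (:- :1) :* :0 := :1) refl)))

  -- Every tight set contains the fractional `e`, so changing `u e` alone leaves all tight cuts
  -- unchanged.
  single-direction : ∀ {u} → (∀ B → ¬ TightMissing u B) → ∀ {e} → ¬ Integral (u e) →
                     Direction u (indicator e)
  single-direction {u} none {e} fractional = direction-from
      (λ j i → indicator-≢ {e} {j} (λ { ≡.refl → fractional i }))
      cuts (e , λ d≈0 → 0≉1 (trans (sym d≈0) (indicator-≡ e)))
    where
    cuts : ∀ A → Tight u A → ∑ (off A (indicator e)) ≈ 0#
    cuts A tA with lookup A e in e∈A | ∑off-indicator A e
    ... | true  | ∑≈0 = ∑≈0
    ... | false | _   = ⊥-elim (none A (tA , e , e∈A , fractional))

  direction-or-vertex : ∀ u → Inside u → (∀ e → Integral (u e)) ⊎ (∃[ d ] Direction u d)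
  direction-or-vertex u in-u with anySubset? (tightMissing? u) | Fin.any? (λ e → ¬? (integral? (u e)))
  ... | yes (B , tm) | _ = inj₂ (exchange (maximal-above u B tm (⊃-wellFounded B)))
    where
    exchange : ∃[ B ] (TightMissing u B × Maximal u B) → ∃[ d ] Direction u d
    exchange (B , (tB , e , mB-e) , maximal) =
      let f , f≢e , mB-f = another-fractional in-u B tB mB-e
      in _ , exchange-direction in-u tB maximal f≢e mB-e mB-f
  ... | no none | yes (e , fractional) = inj₂ (_ , single-direction (λ B tm → none (B , tm)) fractional)
  ... | no _    | no none              = inj₁ (λ e → decidable-stable (integral? (u e)) (λ ¬i → none (e , ¬i)))

  -- Induction for any property closed under two-point convex combinations. Combinations of tours
  -- can thus be mixed directly, without listing the vertices of the polyhedron.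
  module _ (Q : Vector → Set)
    (vertex : ∀ u → Inside u → (∀ e → Integral (u e)) → Q u)
    (mix : ∀ {u v w a b} → Q u → Q v → 0# ≤ a → 0# ≤ b → a + b ≈ 1# → 
           (∀ e → w e ≈ a * u e + b * v e) → Q w)
    where

    convex-induction : ∀ u → Inside u → Acc ℕ._<_ (looseness u) → Q u
    convex-induction u in-u (acc rec) with direction-or-vertex u in-u
    ... | inj₁ integral  = vertex u in-u integral
    ... | inj₂ (d , dir) = combine (advance in-u dir) (advance in-u (opposite dir))
      where
      d⁻ : Vector
      d⁻ e = - d e
      combine : ∃[ ε ] ((0# < ε) × Inside (move u ε d) × looseness (move u ε d) ℕ.< looseness u) →
                ∃[ δ ] ((0# < δ) × Inside (move u δ d⁻) × looseness (move u δ d⁻) ℕ.< looseness u) → Q u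
      combine (ε , 0<ε , in₁ , less₁) (δ , 0<δ , in₂ , less₂) =
        -- The weights are δ/(ε+δ) and ε/(ε+δ), for which the shifts by ε and by -δ along `d`
        -- cancel.
        mix (convex-induction (move u ε d) in₁ (rec less₁)) (convex-induction (move u δ d⁻) in₂ (rec less₂))
          (*-nonneg δ w (<⇒≤ 0<δ) 0≤w) (*-nonneg ε w (<⇒≤ 0<ε) 0≤w) weights average
        where
        0<ε+δ : 0# < ε + δ
        0<ε+δ h = 0<ε (≤-shift₂ h (<⇒≤ 0<δ)
          (solve 2 (λ ε δ → :0 :+ ((ε :+ δ) :+ :0) := ε :+ (:0 :+ δ)) refl ε δ))
        w = proj₁ (positive-inverse 0<ε+δ)
        0≤w : 0# ≤ w
        0≤w = proj₁ (proj₂ (positive-inverse 0<ε+δ))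
        inv : (ε + δ) * w ≈ 1#
        inv = proj₂ (proj₂ (positive-inverse 0<ε+δ))
        weights : δ * w + ε * w ≈ 1#
        weights = trans (solve 3 (λ ε δ w → δ :* w :+ ε :* w := (ε :+ δ) :* w) refl ε δ w) inv
        average : ∀ e → u e ≈ δ * w * move u ε d e + ε * w * move u δ d⁻ e
        average e = trans (sym (*-identityˡ (u e))) (trans (*-congʳ (sym inv))
          (solve 5 (λ ε δ w u d → (ε :+ δ) :* w :* u :=
                              δ :* w :* (u :+ ε :* d) :+ ε :* w :* (u :+ δ :* (:- d)))
            refl ε δ w (u e) (d e)))

    convex-closure : ∀ u → Inside u → Q u
    convex-closure u in-u = convex-induction u in-u (<-wellFounded (looseness u))

-- Euler tours

Fin-≤1-irrelevant : ∀ {k} → k ℕ.≤ 1 → (i j : Fin k) → i ≡ j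
Fin-≤1-irrelevant (ℕ.s≤s ℕ.z≤n) Fin.zero Fin.zero = ≡.refl

another : ∀ {n} → 2 ℕ.≤ n → (v : Fin n) → ∃[ w ] v ≢ w
another (ℕ.s≤s (ℕ.s≤s _)) v = Fin.punchIn v Fin.zero , Fin.punchInᵢ≢i v Fin.zero ∘ ≡.sym

%2-cases : ∀ a → a % 2 ≡ 0 ⊎ a % 2 ≡ 1
%2-cases a with a % 2 | m%n<n a 2
... | 0 | _ = inj₁ ≡.refl
... | 1 | _ = inj₂ ≡.refl
... | suc (suc _) | ℕ.s≤s (ℕ.s≤s ())

module Tours (G : Graph) where
  open Graph G
  open Components G

  Reach-trans : ∀ {χ u v w} → Reach G χ u v → Reach G χ v w → Reach G χ u w
  Reach-trans here              r = r
  Reach-trans (step e χe ends s) r = step e χe ends (Reach-trans s r)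

  Reach-sym : ∀ {χ u v} → Reach G χ u v → Reach G χ v u
  Reach-sym here               = here
  Reach-sym (step e χe ends r) = Reach-trans (Reach-sym r)
    (step e χe (Sum.swap (Sum.map swap swap ends)) here)

  term≤sumℕ : ∀ k (f : Fin k → ℕ) i → f i ℕ.≤ sumℕ G k f
  term≤sumℕ (suc k) f Fin.zero    = ℕ.m≤m+n _ _
  term≤sumℕ (suc k) f (Fin.suc i) = ℕ.≤-trans (term≤sumℕ k (f ∘ Fin.suc) i) (ℕ.m≤n+m _ _)

  sumℕ-+2* : ∀ k (f g h : Fin k → ℕ) → (∀ i → f i ≡ g i ℕ.+ h i ℕ.* 2) →
             sumℕ G k f ≡ sumℕ G k g ℕ.+ sumℕ G k h ℕ.* 2
  sumℕ-+2* zero    f g h eq = ≡.refl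
  sumℕ-+2* (suc k) f g h eq
    rewrite eq Fin.zero | sumℕ-+2* k (f ∘ Fin.suc) (g ∘ Fin.suc) (h ∘ Fin.suc) (eq ∘ Fin.suc) =
    solve 4 (λ a b c d → (a :+ b :* con 2) :+ (c :+ d :* con 2) := (a :+ c) :+ (b :+ d) :* con 2) ≡.refl
      (g Fin.zero) (h Fin.zero) (sumℕ G k (g ∘ Fin.suc)) (sumℕ G k (h ∘ Fin.suc))
    where open +-*-Solver

  incident?-sound : ∀ v e → incident? G v e ≡ true → Incident G v e
  incident?-sound v e eq with src e Fin.≟ v | tgt e Fin.≟ v
  ... | yes s≡v | _       = inj₁ s≡v
  ... | no _    | yes t≡v = inj₂ t≡v

  incident?-complete : ∀ v e → Incident G v e → incident? G v e ≡ true
  incident?-complete v e inc with src e Fin.≟ v | tgt e Fin.≟ v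
  ... | yes _   | _       = ≡.refl
  ... | no _    | yes _   = ≡.refl
  ... | no s≢v  | no t≢v  = ⊥-elim ([ s≢v , t≢v ]′ inc)

  -- The first edge of a walk to a different vertex already counts towards the degree of `u`.
  reach⇒touched : ∀ {χ u v} → u ≢ v → Reach G χ u v → 1 ℕ.≤ degree G χ u
  reach⇒touched u≢v here = ⊥-elim (u≢v ≡.refl)
  reach⇒touched {χ} {u} u≢v (step e χe ends _) = ℕ.≤-trans
    (≡.subst (λ b → 1 ℕ.≤ (if b then χ e else 0))
      (≡.sym (incident?-complete u e (Sum.map proj₁ proj₁ ends))) χe)
    (term≤sumℕ m (λ e → if incident? G u e then χ e else 0) e)

  tour : (Fin m → Bool) → Subset m → Fin m → ℕ
  tour Y S e = if Y e then 1 else (if lookup S e then 2 else 0)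

  tour-Euler : 2 ℕ.≤ n → ∀ Y S → size (components S) ℕ.≤ 1 →
               (∀ v → card G (λ e → incident? G v e ∧ Y e) % 2 ≡ 0) → EulerTour G (tour Y S)
  tour-Euler 2≤n Y S conn Y-even = record { connected = connected ; touches = touches ; even = even }
    where
    used : ∀ e → lookup S e ≡ true → 1 ℕ.≤ tour Y S e
    used e Se rewrite Se with Y e
    ... | true  = ℕ.s≤s ℕ.z≤n
    ... | false = ℕ.s≤s ℕ.z≤n
    connected : ∀ u v → Reach G (tour Y S) u v
    connected u v = components-least S here Reach-sym Reach-trans
      (λ e Se → step e (used e Se) (inj₁ (≡.refl , ≡.refl)) here)
      (Fin-≤1-irrelevant conn (label (components S) u) (label (components S) v))
    touches : ∀ v → 1 ℕ.≤ degree G (tour Y S) v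
    touches v = reach⇒touched (proj₂ (another 2≤n v)) (connected v (proj₁ (another 2≤n v)))
    -- Half the contribution of the edges outside `Y`: the degree at `v` is the number of `Y`-edges
    -- there plus an even number.
    doubled : Fin n → Fin m → ℕ
    doubled v e = if incident? G v e then (if Y e then 0 else (if lookup S e then 1 else 0)) else 0
    split : ∀ v e → (if incident? G v e then tour Y S e else 0) ≡
                    (if incident? G v e ∧ Y e then 1 else 0) ℕ.+ doubled v e ℕ.* 2
    split v e with incident? G v e | Y e | lookup S e
    ... | true  | true  | _     = ≡.refl
    ... | true  | false | true  = ≡.refl
    ... | true  | false | false = ≡.refl
    ... | false | _     | _     = ≡.refl
    even : ∀ v → degree G (tour Y S) v % 2 ≡ 0
    even v = ≡.trans
      (≡.cong (_% 2) (sumℕ-+2* m _ (λ e → if incident? G v e ∧ Y e then 1 else 0) (doubled v) (split v)))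
      (≡.trans ([m+kn]%n≡m%n (card G (λ e → incident? G v e ∧ Y e)) (sumℕ G m (doubled v)) 2) (Y-even v))

-- Convex combinations of tours.

module ConvexCombinations (R : CompleteOrderedField) (G : Graph) where
  open OrderedField R
  open Graph G

  Weighted : Set
  Weighted = Carrier × (Fin m → ℕ)

  scale : Carrier → Weighted → Weighted
  scale a (w , χ) = a * w , χ

  -- Any `f` homogeneous in the weight is allowed, which covers both the total weight and the value
  -- at each edge.
  sumL-mix : (f : Weighted → Carrier) → (∀ a c → f (scale a c) ≈ a * f c) → ∀ a b K L →
             sumL R (map f (map (scale a) K ++ map (scale b) L)) ≈ a * sumL R (map f K) + b * sumL R (map f L)
  sumL-mix f f-scale a b []      []      = solve 2 (λ a b → :0 := a :* :0 :+ b :* :0) refl a b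
  sumL-mix f f-scale a b []      (c ∷ L) = trans (+-cong (f-scale b c) (sumL-mix f f-scale a b [] L))
    (solve 4 (λ a b x y → b :* x :+ (a :* :0 :+ b :* y) := a :* :0 :+ b :* (x :+ y)) refl a b _ _)
  sumL-mix f f-scale a b (c ∷ K) L       = trans (+-cong (f-scale a c) (sumL-mix f f-scale a b K L))
    (solve 5 (λ a b x y z → a :* x :+ (a :* y :+ b :* z) := a :* (x :+ y) :+ b :* z) refl a b _ _ _)

  convex-mix : ∀ {x x′ x″ a b} → ConvexCombOfEulerTours G R x → ConvexCombOfEulerTours G R x′ →
               0# ≤ a → 0# ≤ b → a + b ≈ 1# → (∀ e → x″ e ≈ a * x e + b * x′ e) →
               ConvexCombOfEulerTours G R x″
  convex-mix {x} {x′} {x″} {a} {b} (K , K-ok , K-sum , K-x) (L , L-ok , L-sum , L-x) 0≤a 0≤b a+b≈1 x″-eq =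
      map (scale a) K ++ map (scale b) L
    , (λ c∈ → [ ok 0≤a K-ok , ok 0≤b L-ok ]′ (∈-++⁻ (map (scale a) K) c∈))
    , trans (sumL-mix proj₁ (λ _ _ → refl) a b K L)
        (trans (+-cong (trans (*-congˡ K-sum) (*-identityʳ a)) (trans (*-congˡ L-sum) (*-identityʳ b))) a+b≈1)
    , λ e → trans (x″-eq e) (trans (+-cong (*-congˡ (K-x e)) (*-congˡ (L-x e)))
        (sym (sumL-mix (λ c → proj₁ c * fromℕ R (proj₂ c e)) (λ a c → *-assoc a (proj₁ c) _) a b K L)))
    where
    ok : ∀ {a M c} → 0# ≤ a → (∀ {c} → c ∈ M → (0# ≤ proj₁ c) × EulerTour G (proj₂ c)) →
         c ∈ map (scale a) M → (0# ≤ proj₁ c) × EulerTour G (proj₂ c)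
    ok {a} {M} 0≤a M-ok c∈ with ∈-map⁻ (scale a) {xs = M} c∈
    ... | (w , χ) , c∈M , ≡.refl = *-nonneg a w 0≤a (proj₁ (M-ok c∈M)) , proj₂ (M-ok c∈M)

  convex-tour : ∀ {x χ} → EulerTour G χ → (∀ e → x e ≈ fromℕ R (χ e)) → ConvexCombOfEulerTours G R x
  convex-tour {x} {χ} χ-tour x-eq =
      (1# , χ) ∷ []
    , (λ { (here ≡.refl) → 0≤1 , χ-tour })
    , +-identityʳ 1#
    , λ e → trans (x-eq e) (sym (trans (+-identityʳ _) (*-identityˡ _)))

  convex-resp : ∀ {x x′} → (∀ e → x′ e ≈ x e) → ConvexCombOfEulerTours G R x → ConvexCombOfEulerTours G R x′
  convex-resp x′≈x (L , L-ok , L-sum , L-x) = L , L-ok , L-sum , λ e → trans (x′≈x e) (L-x e)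

-- Decomposing a feasible point.

module _ (R : CompleteOrderedField) (G : Graph) (2≤n : 2 ℕ.≤ Graph.n G)
  {x y z t : Fin (Graph.m G) → CompleteOrderedField.Carrier R} (feasible : Feasible G R x y z t) where
  open OrderedField R
  open Graph G
  open Feasible feasible
  open Components G
  open Tours G
  open ConvexCombinations R G
  open BoxPolyhedron R (size ∘ components) components-supermodular

  Y : Fin m → Bool
  Y e = [ (λ _ → false) , (λ _ → true) ]′ (c4-7 e)

  Y-true : ∀ {e} → Y e ≡ true → y e ≈ 1#
  Y-true {e} Ye with c4-7 e
  ... | inj₂ y≈1 = y≈1

  Y-false : ∀ {e} → Y e ≡ false → y e ≈ 0#
  Y-false {e} Ye with c4-7 e
  ... | inj₁ y≈0 = y≈0

  -- If `F` had odd size, its constraint would read 1 ≤ 0: edges of `F` contribute 1 - 1, and the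
  -- other edges at `v` have `y` equal to 0.
  Y-even : ∀ v → card G (λ e → incident? G v e ∧ Y e) % 2 ≡ 0
  Y-even v = [ (λ even → even) , (λ odd → ⊥-elim (0<1 (≤-resp refl (∑-zero zeros)
      (c4-2 v F (λ e Fe → incident?-sound v e (proj₁ (∧-true Fe))) odd)))) ]′ (%2-cases (card G F))
    where
    F : Fin m → Bool
    F e = incident? G v e ∧ Y e
    ∧-true : ∀ {a b} → a ∧ b ≡ true → a ≡ true × b ≡ true
    ∧-true {true} {true} _ = ≡.refl , ≡.refl
    zeros : ∀ e → (if F e then 1# - y e else (if incident? G v e then y e else 0#)) ≈ 0#
    zeros e with incident? G v e | Y e in Ye
    ... | true  | true  = trans (+-congˡ (-‿cong (Y-true Ye))) (-‿inverseʳ 1#)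
    ... | true  | false = Y-false Ye
    ... | false | _     = refl

  u : Vector
  u e = y e + z e

  0≤u : ∀ e → 0# ≤ u e
  0≤u e = ≤-trans (proj₁ (c4-5 e)) (proj₁ (c4-4 e))

  u-inside : Inside u
  u-inside (lower e) = 0≤u e
  u-inside (upper e) = ≤-shift (proj₂ (c4-4 e)) (solve 1 (λ u → (:1 :- u) :+ u := :0 :+ :1) refl (u e))
  -- The partition constraint is applied to the components of `B`. Crossing edges lie outside `B`
  -- and satisfy `t ≤ u`; the other edges outside `B` only add nonnegative terms.
  u-inside (cut B)   = ≤-shift (≤-trans (c4-3 (size P) (label P) (onto P)) (∑-mono-≤ crossing≤off))
      (solve 2 (λ s k → ((:1 :+ s) :- k) :+ (k :- :1) := :0 :+ s) refl (∑ (off B u)) (fromℕ R (size P)))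
    where
    P = components B
    crossing≤off : ∀ e → (if crossing G (label P) e then t e else 0#) ≤ off B u e
    crossing≤off e with lookup B e in Be | label P (src e) Fin.≟ label P (tgt e)
    ... | true  | yes _  = ≤-refl
    ... | true  | no ne  = ⊥-elim (ne (components-joins B Be))
    ... | false | yes _  = 0≤u e
    ... | false | no _   = proj₁ (c4-4 e)

  -- An affine map taking `u` to `x` and the 0/1 points of the polyhedron to tours; being affine, it
  -- respects convex combinations.
  doubling : Vector → Vector
  doubling v e = if Y e then 1# else (1# + 1#) * v e

  x≈doubling : ∀ e → x e ≈ doubling u e
  x≈doubling e with Y e in Ye
  ... | true  = trans (c4-1 e) (trans (+-cong (Y-true Ye) (*-congˡ z≈0))
      (solve 0 (:1 :+ (:1 :+ :1) :* :0 := :1) refl))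
    where
    z≈0 : z e ≈ 0#
    z≈0 = antisym (≤-shift (proj₂ (c4-4 e)) (trans (+-congˡ (+-congʳ (Y-true Ye)))
      (solve 1 (λ z → :0 :+ (:1 :+ z) := z :+ :1) refl (z e)))) (proj₁ (c4-6 e))
  ... | false = trans (c4-1 e) (trans (+-congʳ (Y-false Ye)) (trans
      (solve 1 (λ z → :0 :+ (:1 :+ :1) :* z := (:1 :+ :1) :* (:0 :+ z)) refl (z e))
      (*-congˡ (+-congʳ (sym (Y-false Ye))))))

  vertex-tour : ∀ v → Inside v → (∀ e → Integral (v e)) → ConvexCombOfEulerTours G R (doubling v)
  vertex-tour v in-v integral = convex-tour (tour-Euler 2≤n Y S one-component Y-even) value
    where
    S : Subset m
    S = tabulate (λ e → not (does (v e ≈? 0#)))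
    S-value : ∀ e → v e ≈ (if lookup S e then 1# else 0#)
    S-value e rewrite lookup∘tabulate (λ e → not (does (v e ≈? 0#))) e with v e ≈? 0# | integral e
    ... | yes v≈0 | _         = v≈0
    ... | no  v≉0 | inj₁ v≈0 = ⊥-elim (v≉0 v≈0)
    ... | no  _   | inj₂ v≈1 = v≈1
    off-zero : ∀ e → off S v e ≈ 0#
    off-zero e with lookup S e | S-value e
    ... | true  | _   = refl
    ... | false | v≈0 = v≈0
    one-component : size (components S) ℕ.≤ 1
    -- The cut constraint of `S` itself gives the bound, since `v` vanishes outside `S`.
    one-component = fromℕ-cancel-≤ (≤-shift (in-v (cut S)) (trans
      (solve 1 (λ k → (:1 :+ :0) :+ :0 := k :+ ((:1 :+ :0) :- k)) refl _)
      (+-congˡ (+-congʳ (+-congˡ (sym (∑-zero off-zero)))))))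
    value : ∀ e → doubling v e ≈ fromℕ R (tour Y S e)
    value e with Y e | lookup S e | S-value e
    ... | true  | _     | _   = sym (+-identityʳ 1#)
    ... | false | true  | v≈1 = trans (*-congˡ v≈1) (solve 0 ((:1 :+ :1) :* :1 := :1 :+ (:1 :+ :0)) refl)
    ... | false | false | v≈0 = trans (*-congˡ v≈0) (zeroʳ _)

  doubling-mix : ∀ {v v′ w a b} → a + b ≈ 1# → (∀ e → w e ≈ a * v e + b * v′ e) →
                 ∀ e → doubling w e ≈ a * doubling v e + b * doubling v′ e
  doubling-mix {a = a} {b} a+b≈1 w-eq e with Y e
  -- On `Y` the map is constantly 1, which mixes to a + b.
  ... | true  = trans (sym a+b≈1) (sym (+-cong (*-identityʳ a) (*-identityʳ b)))
  ... | false = trans (*-congˡ (w-eq e))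
    (solve 4 (λ a b v v′ → (:1 :+ :1) :* (a :* v :+ b :* v′)
      := a :* ((:1 :+ :1) :* v) :+ b :* ((:1 :+ :1) :* v′)) refl a b _ _)

  x-convex : ConvexCombOfEulerTours G R x
  x-convex = convex-resp x≈doubling
    -- The induction runs on `u`, while the property concerns the image under `doubling`.
    (convex-closure (λ v → ConvexCombOfEulerTours G R (doubling v)) vertex-tour
    (λ cv cv′ 0≤a 0≤b a+b≈1 w-eq → convex-mix cv cv′ 0≤a 0≤b a+b≈1 (doubling-mix a+b≈1 w-eq))
    u u-inside)

theorem1 : (R : CompleteOrderedField) (G : Graph) → IsSimple G →
    2 ℕ.≤ Graph.n G →
    (x y z t : Fin (Graph.m G) → CompleteOrderedField.Carrier R) →
    Feasible G R x y z t →
    ConvexCombOfEulerTours G R x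
theorem1 R G _ 2≤n x y z t feasible = x-convex R G 2≤n feasible
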